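{- Let $d,f$ be positive integers and $G$ a graph on $n$ vertices of degeneracy $d$. Let $\mathcal{F}$ be a $4d$-neighborhood-witnessing layered family of $G$ with thickness at most $\lceil\log n\rceil$, and let $A,B\subseteq V(G)$. Then at least one of the following exists: (1) an $A$--$B$ separator $S\subseteq V(G)$ in $G$ with $\mathrm{fcov}_{\mathcal{F}}(S)\le 8\log^2 2n\cdot f$; (2) an induced subgraph $H$ of $G$ of maximum degree at most $12\log^2 2n+4d$ such that every $A_H$--$B_H$ separator $S$ in $H$ satisfies $\mathrm{cov}_{\mathcal{F}}(S)\ge\frac f6$, where $A_H:=A\cap V(H)$ and $B_H:=B\cap V(H)$.
   Context: Logarithms are base 2. Layered family: given an ordered partition $\Pi=(L_1,\dots,L_m)$ of $V(G)$, the layer digraph has an arc $(u,v)$ iff $uv\in E(G)$, $u\in L_i$, $v\in L_j$, $j<i$. $v$ is a descendant of $u$ if there is a directed path from $u$ to $v$ (including $v=u$). For each vertex $u$ with no in-arcs, the set of $u$ and all its descendants belongs to $\mathcal{F}$. Thickness: smallest $k$ such that every member meets at most $k$ parts of $\Pi$. $\mathcal{F}$ is $4d$-neighborhood-witnessing if for every vertex $v$ and every $F\in\mathcal{F}$ containing $v$, $|N[v]\setminus F|\le 4d$. An $A$--$B$ separator meets every path from $A$ to $B$. $\mathrm{fcov}_{\mathcal{F}}(S)$ is the minimum of $\sum_F y_F$ over nonnegative $\{y_F\}$ with $\sum_{F\ni v}y_F\ge1$ for all $v\in S$; $\mathrm{cov}_{\mathcal{F}}(S)$ is the minimum number of members of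 $\mathcal{F}$ whose union contains $S$. -}

module Defs where

open import Data.Nat as ℕ using (ℕ; zero; suc; _+_; _*_; _∸_; _^_)
open import Data.Nat.Logarithm using (⌈log₂_⌉)
open import Data.Integer using (+_)
open import Data.Rational as ℚ using (ℚ; 0ℚ; 1ℚ)
open import Data.Fin using (Fin; _<_)
open import Data.Fin.Subset using (Subset; _∈_; _∩_; _⊆_; ∣_∣; Nonempty)
open import Data.Vec using (tabulate)
open import Data.Bool using (Bool; true)
open import Data.List using (List; []; _∷_; map; foldr; allFin; length)
open import Data.List.Relation.Unary.All using (All)
open import Data.List.Relation.Unary.Any using (Any)
open import Data.List.Relation.Unary.Linked using (Linked)
open import Data.List.Relation.Unary.Unique.Propositional using (Unique)
open import Data.Product using (Σ; ∃; _×_)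
open import Data.Sum using (_⊎_)
open import Data.Empty using (⊥)
open import Function.Definitions using (Injective)
open import Relation.Binary.PropositionalEquality using (_≡_)
open import Relation.Nullary using (¬_)

record Graph (n : ℕ) : Set where
  field
    adj   : Fin n → Fin n → Bool
    sym   : ∀ u v → adj u v ≡ adj v u
    irrefl : ∀ v → adj v v ≡ true → ⊥
open Graph public



module _ {n : ℕ} (G : Graph n) where

  Adj : Fin n → Fin n → Set
  Adj u v = adj G u v ≡ true

  N : Fin n → Subset n
  N v = tabulate (adj G v)

  degIn : Subset n → Fin n → ℕ
  degIn X v = ∣ N v ∩ X ∣

  Degenerate : ℕ → Set
  Degenerate k = ∀ (X : Subset n) → Nonempty X → ∃ λ v → v ∈ X × degIn X v ℕ.≤ k

  HasDegeneracy : ℕ → Set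
  HasDegeneracy zero    = Degenerate zero
  HasDegeneracy (suc k) = Degenerate (suc k) × ¬ Degenerate k

  lastOf : Fin n → List (Fin n) → Fin n
  lastOf a []       = a
  lastOf a (p ∷ ps) = lastOf p ps

  Separator : (X A B S : Subset n) → Set
  Separator X A B S =
    ∀ (a : Fin n) (ps : List (Fin n)) →
      a ∈ A → lastOf a ps ∈ B →
      Linked Adj (a ∷ ps) → Unique (a ∷ ps) → All (_∈ X) (a ∷ ps) →
      Any (_∈ S) (a ∷ ps)

  -- Layered family of an ordered partition Π = (L_1,…,L_m), given by the
  -- layer map ℓ : Fin n → Fin m (v ∈ L_{ℓ v}); surjectivity = parts nonempty.

  module Layered {m : ℕ} (ℓ : Fin n → Fin m) where

    IsOrderedPartition : Set
    IsOrderedPartition = ∀ (j : Fin m) → ∃ λ v → ℓ v ≡ j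

    Arc : Fin n → Fin n → Set
    Arc u v = Adj u v × ℓ v < ℓ u

    data Reach : Fin n → Fin n → Set where
      here  : ∀ {u} → Reach u u
      there : ∀ {u w v} → Arc u w → Reach w v → Reach u v

    -- u has no in-arcs; the members of 𝓕 are the sets D(u) = {v | Reach u v}
    -- for such u.
    Source : Fin n → Set
    Source u = ∀ w → ¬ Arc w u

    AtMost : {t : ℕ} → ℕ → (Fin t → Set) → Set
    AtMost {t} k P = ∀ (g : Fin (suc k) → Fin t) → Injective _≡_ _≡_ g → ¬ (∀ i → P (g i))

    ThicknessAtMost : ℕ → Set
    ThicknessAtMost k = ∀ u → Source u → AtMost k (λ j → ∃ λ v → Reach u v × ℓ v ≡ j)

    InClosedN : Fin n → Fin n → Set
    InClosedN v w = w ≡ v ⊎ Adj v w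

    NeighborhoodWitnessing : ℕ → Set
    NeighborhoodWitnessing k =
      ∀ u v → Source u → Reach u v → AtMost k (λ w → InClosedN v w × ¬ Reach u w)

    sumℚ : List ℚ → ℚ
    sumℚ = foldr ℚ._+_ 0ℚ

    -- y (a weight on vertices; weight on u stands for y_{D(u)}, weights on
    -- non-sources are useless but only increase the total) is a fractional
    -- 𝓕-cover of S: y ≥ 0 and for each v ∈ S the weights of the members
    -- containing v sum to ≥ 1 (witnessed by a duplicate-free list of such
    -- members; as y ≥ 0 this is equivalent to the full sum being ≥ 1).
    FracCover : Subset n → (Fin n → ℚ) → Set
    FracCover S y =
      (∀ u → 0ℚ ℚ.≤ y u) ×
      (∀ v → v ∈ S → ∃ λ (us : List (Fin n)) →
          Unique us × All (λ u → Source u × Reach u v) us × 1ℚ ℚ.≤ sumℚ (map y us))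

    totalWeight : (Fin n → ℚ) → ℚ
    totalWeight y = sumℚ (map y (allFin n))

    Cover : Subset n → List (Fin n) → Set
    Cover S us = All Source us × (∀ v → v ∈ S → Any (λ u → Reach u v) us)

    CovAtLeastSixth : Subset n → ℕ → Set
    CovAtLeastSixth S f = ∀ us → Cover S us → f ℕ.≤ 6 * length us

-- Comparison with c · (log₂ m)² for a rational x, c ≥ 1, m ≥ 1:
--   x ≤ c · (log₂ m)²
-- is encoded as: for every rational r = a/(b+1) ≥ 0 with c·r² < x we have
-- 2^r ≤ m, i.e. 2^a ≤ m^(b+1).  (Since r ↦ c r² is increasing on r ≥ 0 and
-- the rationals are dense, this is equivalent to √(x/c) ≤ log₂ m.)

ℕtoℚ : ℕ → ℚ
ℕtoℚ k = + k ℚ./ 1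

LeCLog² : ℚ → ℕ → ℕ → Set
LeCLog² x c m =
  ∀ (a b : ℕ) → ℕtoℚ (c * (a * a)) ℚ.< x ℚ.* ℕtoℚ (suc b * suc b) →
    2 ^ a ℕ.≤ m ^ suc b

{-# OPTIONS --safe #-}
module Submission where

-- Put T = ⌈log n⌉ and give the member of 𝓕 below a source u the weight 2^h, where h is the
-- number of A–B walks selected so far that meet it.  Let W be the total weight and let a
-- vertex cost the weight of the members containing it.
--
-- If some A–B walk costs at most 2W/f, select it, after rerouting it: between two of its
-- vertices in a member it can go up to the source of that member and down again.  Ancestors
-- lie in fewer members, so no new member is met, and a shortest such walk has at most 2T
-- vertices in each member.  Each selection multiplies W by at most 1 + 2/f ≤ (1 + 1/f)², so
-- after 2T⌈f/2⌉ ≥ fT selections W ≤ 2^(5T) and each member meets at most 5T selected walks.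
-- Let H be induced by the selected walks: it has at most 10T² vertices in each member, and
-- c members meet at most 5Tc of the walks.
--
-- If no A–B walk is that cheap, take the boundary of the ball of radius s around B for a
-- suitable s ≤ 2W/f.  Light vertices of a common member are close to each other (through its
-- source), so at each of the O(T) dyadic scales of vertex costs a member meets the boundaries
-- of few balls only; averaging over s bounds the weight of the fractional cover that gives
-- each member its weight divided by the least cost of its vertices on the boundary.

open import Defs hiding (sym)
open import Algebra.Properties.Semiring.Sum using ()
import Data.Bool.Properties as Bool
open import Data.Bool using (true)
open import Data.Fin as Fin using (Fin; zero; suc; toℕ)
import Data.Fin.Properties as Fin
open import Data.Fin.Subset using (Subset; inside; outside; ⊤; ⊥; ⁅_⁆; _∈_; _∪_; _∩_; _⊆_; ∣_∣)
open import Data.Fin.Subset.Properties using (_∈?_; ∣⊥∣≡0; ∣⁅x⁆∣≡1; p⊆q⇒∣p∣≤∣q∣; x∈p∪q⁺; x∈⁅x⁆; x∈p∩q⁺; x∈p∩q⁻)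
import Data.Integer as ℤ
import Data.Integer.Properties as ℤ
open import Data.List as List using (List; []; _∷_; _++_; length; filter; map; allFin)
open import Data.List.Membership.Propositional using (find; lose) renaming (_∈_ to _∈ˡ_)
open import Data.List.Membership.Propositional.Properties using (∈-filter⁺; ∈-++⁺ˡ; ∈-++⁺ʳ)
open import Data.List.Properties using (length-++; filter-none)
open import Data.List.Relation.Unary.All as All using (All; []; _∷_)
open import Data.List.Relation.Unary.All.Properties using (¬Any⇒All¬; all-filter)
open import Data.List.Relation.Unary.AllPairs using ([]; _∷_)
open import Data.List.Relation.Unary.Any as Any using (Any; here; there)
open import Data.List.Relation.Unary.Linked using (Linked; []; [-]; _∷_)
open import Data.List.Relation.Unary.Unique.Propositional using (Unique)
import Data.List.Relation.Unary.Unique.Propositional.Properties as Unique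
open import Data.Nat using (ℕ; zero; suc; _+_; _*_; _∸_; _^_; _/_; _%_; _≤_; _<_; z≤n; s≤s; z<s; NonZero; >-nonZero; _≤?_; _<?_; ⌈_/2⌉; ⌊_/2⌋)
open import Data.Nat.DivMod using (m≡m%n+[m/n]*n; m%n<n; m/n*n≤m)
open import Data.Nat.Induction using (<-rec)
open import Data.Nat.ListAction using () renaming (sum to sumˡ)
open import Data.Nat.Logarithm using (⌈log₂_⌉; ⌈log₂⌉-mono-≤; ⌈log₂⌈n/2⌉⌉≡⌈log₂n⌉∸1; ⌈log₂2*n⌉≡1+⌈log₂n⌉; ⌈log₂2^n⌉≡n)
open import Data.Nat.Properties
open import Data.Nat.Tactic.RingSolver using (solve-∀)
open import Data.Product using (∃; Σ; _×_; _,_; proj₁; proj₂)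
open import Data.Rational as ℚ using (ℚ; 0ℚ; 1ℚ; toℚᵘ)
import Data.Rational.Properties as ℚ
open import Data.Rational.Unnormalised as ℚᵘ using (mkℚᵘ; *≡*; *≤*)
import Data.Rational.Unnormalised.Properties as ℚᵘ
open import Data.Sum using (_⊎_; inj₁; inj₂; [_,_]′)
open import Data.Vec as Vec using ([]; _∷_; tabulate)
open import Data.Vec.Properties using (lookup∘tabulate; []=⇒lookup; lookup⇒[]=)
open import Function using (_∘_; id)
open import Function.Definitions using (Injective)
open import Relation.Binary.Construct.Closure.ReflexiveTransitive using (Star; ε; _◅_; _◅◅_)
open import Relation.Binary.Definitions using (tri<; tri≈; tri>)
open import Relation.Binary.PropositionalEquality using (_≡_; refl; sym; trans; cong; cong₂; subst; module ≡-Reasoning)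
open import Relation.Nullary using (¬_; Dec; yes; no; does; contradiction; map′; ¬?; _×-dec_; _⊎-dec_)
open import Relation.Nullary.Decidable using (dec-true)
open import Relation.Unary using (Pred; Decidable)

open Algebra.Properties.Semiring.Sum +-*-semiring using (sum; ∑-comm; *-distribˡ-sum; *-distribʳ-sum; ∑-distrib-+; sum-cong-≗)

-- Arithmetic

n≤2^⌈log₂n⌉ : ∀ n → n ≤ 2 ^ ⌈log₂ n ⌉
n≤2^⌈log₂n⌉ = <-rec _ step
  where
  open ≤-Reasoning
  step : ∀ n → (∀ {k} → k < n → k ≤ 2 ^ ⌈log₂ k ⌉) → n ≤ 2 ^ ⌈log₂ n ⌉
  step zero          _   = z≤n
  step (suc zero)    _   = ≤-refl
  step n@(suc (suc k)) rec = begin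
    n                              ≡⟨ ⌊n/2⌋+⌈n/2⌉≡n n ⟨
    ⌊ n /2⌋ + ⌈ n /2⌉              ≤⟨ +-mono-≤ (≤-trans (⌊n/2⌋≤⌈n/2⌉ n) c≤) c≤ ⟩
    2 ^ t + 2 ^ t                  ≡⟨ cong (_+_ (2 ^ t)) (+-identityʳ _) ⟨
    2 ^ suc t                      ≡⟨ cong (2 ^_) (m+[n∸m]≡n (⌈log₂⌉-mono-≤ {2} {n} (s≤s (s≤s z≤n)))) ⟩
    2 ^ ⌈log₂ n ⌉                  ∎
    where
    t = ⌈log₂ n ⌉ ∸ 1
    c≤ : ⌈ n /2⌉ ≤ 2 ^ t
    c≤ = subst (λ e → ⌈ n /2⌉ ≤ 2 ^ e) (⌈log₂⌈n/2⌉⌉≡⌈log₂n⌉∸1 n) (rec (⌈n/2⌉<n k))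

-- All estimates are made with T = `⌈log₂ n ⌉`; as T is at most log 2n, they yield bounds in log 2n.
-- If 2n were below 2^T, taking logarithms would give T + 1 ≤ T.
2^⌈log₂n⌉≤2n : ∀ n .{{_ : NonZero n}} → 2 ^ ⌈log₂ n ⌉ ≤ 2 * n
2^⌈log₂n⌉≤2n n = ≮⇒≥ λ 2n<2^T → 1+n≰n (begin
  suc ⌈log₂ n ⌉          ≡⟨ ⌈log₂2*n⌉≡1+⌈log₂n⌉ n ⟨
  ⌈log₂ (2 * n) ⌉        ≤⟨ ⌈log₂⌉-mono-≤ (<⇒≤ 2n<2^T) ⟩
  ⌈log₂ (2 ^ ⌈log₂ n ⌉) ⌉ ≡⟨ ⌈log₂2^n⌉≡n ⌈log₂ n ⌉ ⟩
  ⌈log₂ n ⌉              ∎)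
  where open ≤-Reasoning

^-reflects-≤ : ∀ {a b} → 2 ^ a ≤ 2 ^ b → a ≤ b
^-reflects-≤ 2^a≤2^b = ≮⇒≥ λ b<a → <⇒≱ (^-monoʳ-< 2 (s≤s (s≤s z≤n)) b<a) 2^a≤2^b

m<[1+m/n]*n : ∀ m n .{{_ : NonZero n}} → m < suc (m / n) * n
m<[1+m/n]*n m n = begin-strict
  m                   ≡⟨ m≡m%n+[m/n]*n m n ⟩
  m % n + m / n * n   <⟨ +-monoˡ-< (m / n * n) (m%n<n m n) ⟩
  suc (m / n) * n     ∎
  where open ≤-Reasoning

-- Bernoulli's inequality for (1 - 1/(f+1))^k, cleared of denominators.
bernoulli : ∀ f k j → k + j ≡ suc f → suc f ^ k * j ≤ suc f * f ^ k
bernoulli f zero    j refl = ≤-reflexive (trans (+-identityʳ _) (sym (*-identityʳ _)))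
bernoulli f (suc k) j eq   = begin
  suc f * suc f ^ k * j       ≡⟨ rearrange f (suc f ^ k) j ⟩
  suc f ^ k * (suc f * j)     ≤⟨ *-monoʳ-≤ (suc f ^ k) j+fj≤ ⟩
  suc f ^ k * (f * suc j)     ≡⟨ rearrange′ f (suc f ^ k) (suc j) ⟩
  f * (suc f ^ k * suc j)     ≤⟨ *-monoʳ-≤ f (bernoulli f k (suc j) (trans (+-suc k j) eq)) ⟩
  f * (suc f * f ^ k)         ≡⟨ rearrange″ f (f ^ k) ⟩
  suc f * (f * f ^ k)         ∎
  where
  open ≤-Reasoning
  rearrange : ∀ f p j → suc f * p * j ≡ p * (suc f * j)
  rearrange = solve-∀
  rearrange′ : ∀ f p j → p * (f * j) ≡ f * (p * j)
  rearrange′ = solve-∀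
  rearrange″ : ∀ f p → f * (suc f * p) ≡ suc f * (f * p)
  rearrange″ = solve-∀
  j+fj≤ : suc f * j ≤ f * suc j
  j+fj≤ = subst (suc f * j ≤_) (sym (*-suc f j))
            (+-monoˡ-≤ (f * j) (subst (j ≤_) (suc-injective eq) (m≤n+m j k)))

-- For positive `f` this is (1 + 1/f)^⌈f/2⌉ ≤ 2: in Bernoulli's inequality the remainder `j` is at
-- least half of `suc f`.
[1+f]^⌈f/2⌉≤2f^⌈f/2⌉ : ∀ f → suc f ^ ⌈ f /2⌉ ≤ 2 * f ^ ⌈ f /2⌉
[1+f]^⌈f/2⌉≤2f^⌈f/2⌉ f = *-cancelˡ-≤ (suc f) (begin
  suc f * suc f ^ g         ≡⟨ *-comm (suc f) (suc f ^ g) ⟩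
  suc f ^ g * suc f         ≤⟨ *-monoʳ-≤ (suc f ^ g) 1+f≤2j ⟩
  suc f ^ g * (2 * j)       ≡⟨ rearrange (suc f ^ g) j ⟩
  2 * (suc f ^ g * j)       ≤⟨ *-monoʳ-≤ 2 (bernoulli f g j g+j) ⟩
  2 * (suc f * f ^ g)       ≡⟨ rearrange′ (suc f) (f ^ g) ⟩
  suc f * (2 * f ^ g)       ∎)
  where
  open ≤-Reasoning
  g = ⌈ f /2⌉
  j = ⌈ suc f /2⌉
  -- `g` is `⌊ suc f /2⌋` by definition, so `g` and `j` are the two halves of `suc f`.
  g+j : g + j ≡ suc f
  g+j = ⌊n/2⌋+⌈n/2⌉≡n (suc f)
  1+f≤2j : suc f ≤ 2 * j
  1+f≤2j = begin
    suc f         ≡⟨ g+j ⟨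
    g + j         ≤⟨ +-monoˡ-≤ j (⌊n/2⌋≤⌈n/2⌉ (suc f)) ⟩
    j + j         ≡⟨ cong (j +_) (+-identityʳ j) ⟨
    2 * j         ∎
  rearrange : ∀ p j → p * (2 * j) ≡ 2 * (p * j)
  rearrange = solve-∀
  rearrange′ : ∀ p q → 2 * (p * q) ≡ p * (2 * q)
  rearrange′ = solve-∀

f≤2⌈f/2⌉ : ∀ f → f ≤ 2 * ⌈ f /2⌉
f≤2⌈f/2⌉ f = begin
  f                     ≡⟨ ⌊n/2⌋+⌈n/2⌉≡n f ⟨
  ⌊ f /2⌋ + ⌈ f /2⌉     ≤⟨ +-monoˡ-≤ _ (⌊n/2⌋≤⌈n/2⌉ f) ⟩
  ⌈ f /2⌉ + ⌈ f /2⌉     ≡⟨ cong (⌈ f /2⌉ +_) (+-identityʳ _) ⟨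
  2 * ⌈ f /2⌉           ∎
  where open ≤-Reasoning

^-distribʳ-* : ∀ k a b → (a * b) ^ k ≡ a ^ k * b ^ k
^-distribʳ-* zero    a b = refl
^-distribʳ-* (suc k) a b = trans (cong (a * b *_) (^-distribʳ-* k a b)) (rearrange a b (a ^ k) (b ^ k))
  where
  rearrange : ∀ a b p q → a * b * (p * q) ≡ a * p * (b * q)
  rearrange = solve-∀

[1+f]^e≤2^4T*f^e : ∀ f T → (suc f) ^ (⌈ f /2⌉ * (4 * T)) ≤ 2 ^ (4 * T) * f ^ (⌈ f /2⌉ * (4 * T))
[1+f]^e≤2^4T*f^e f T = begin
  suc f ^ (g * (4 * T))                 ≡⟨ ^-*-assoc (suc f) g (4 * T) ⟨
  (suc f ^ g) ^ (4 * T)                 ≤⟨ ^-monoˡ-≤ (4 * T) ([1+f]^⌈f/2⌉≤2f^⌈f/2⌉ f) ⟩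
  (2 * f ^ g) ^ (4 * T)                 ≡⟨ ^-distribʳ-* (4 * T) 2 (f ^ g) ⟩
  2 ^ (4 * T) * (f ^ g) ^ (4 * T)       ≡⟨ cong (2 ^ (4 * T) *_) (^-*-assoc f g (4 * T)) ⟩
  2 ^ (4 * T) * f ^ (g * (4 * T))       ∎
  where
  open ≤-Reasoning
  g = ⌈ f /2⌉

-- `J ∸ k` is the integer part of log₂ x, found by lowering `J` until 2^J ≤ x.
dyadic-scale : ∀ J x → 1 ≤ x → x < 2 ^ suc J →
               ∃ λ k → k ≤ J × 2 ^ J ≤ 2 ^ k * x × x < 2 ^ (suc J ∸ k)
dyadic-scale zero    x 1≤x x<2 = 0 , z≤n , subst (1 ≤_) (sym (+-identityʳ x)) 1≤x , x<2
dyadic-scale (suc J) x 1≤x x<  with x <? 2 ^ suc J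
... | no  x≮ = 0 , z≤n , subst (2 ^ suc J ≤_) (sym (+-identityʳ x)) (≮⇒≥ x≮) , x<
... | yes x<′ with dyadic-scale J x 1≤x x<′
...   | k , k≤J , 2^J≤ , x<k =
        suc k , s≤s k≤J , subst (2 ^ suc J ≤_) (sym (*-assoc 2 (2 ^ k) x)) (*-monoʳ-≤ 2 2^J≤) , x<k

-- Finite sums and counting

𝟙 : ∀ {p} {P : Set p} → Dec P → ℕ
𝟙 (yes _) = 1
𝟙 (no  _) = 0

module _ {p} {P : Set p} where

  𝟙-yes : (P? : Dec P) → P → 𝟙 P? ≡ 1
  𝟙-yes (yes _) _  = refl
  𝟙-yes (no ¬p) p₁ = contradiction p₁ ¬p

  𝟙-no : (P? : Dec P) → ¬ P → 𝟙 P? ≡ 0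
  𝟙-no (yes p₁) ¬p = contradiction p₁ ¬p
  𝟙-no (no _)   _  = refl

  𝟙≤1 : (P? : Dec P) → 𝟙 P? ≤ 1
  𝟙≤1 (yes _) = ≤-refl
  𝟙≤1 (no _)  = z≤n

𝟙-mono : ∀ {p q} {P : Set p} {Q : Set q} (P? : Dec P) (Q? : Dec Q) → (P → Q) → 𝟙 P? ≤ 𝟙 Q?
𝟙-mono (yes p) Q? P⇒Q = ≤-reflexive (sym (𝟙-yes Q? (P⇒Q p)))
𝟙-mono (no _)  Q? P⇒Q = z≤n

𝟙-⊎ : ∀ {p q r} {P : Set p} {Q : Set q} {R : Set r} (P? : Dec P) (Q? : Dec Q) (R? : Dec R) →
      (P → Q ⊎ R) → 𝟙 P? ≤ 𝟙 Q? + 𝟙 R?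
𝟙-⊎ (no _)  Q?      R?      _ = z≤n
𝟙-⊎ (yes _) (yes _) R?      _ = s≤s z≤n
𝟙-⊎ (yes _) (no _)  (yes _) _ = ≤-refl
𝟙-⊎ (yes p) (no ¬q) (no ¬r) P⇒Q⊎R = [ (λ q → contradiction q ¬q) , (λ r → contradiction r ¬r) ]′ (P⇒Q⊎R p)

sum-mono : ∀ {n} {f g : Fin n → ℕ} → (∀ i → f i ≤ g i) → sum f ≤ sum g
sum-mono {zero}  f≤g = z≤n
sum-mono {suc n} f≤g = +-mono-≤ (f≤g zero) (sum-mono (f≤g ∘ suc))

term≤sum : ∀ {n} (f : Fin n → ℕ) i → f i ≤ sum f
term≤sum f zero    = m≤m+n _ _
term≤sum f (suc i) = ≤-trans (term≤sum (f ∘ suc) i) (m≤n+m _ _)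

sum≤n*c : ∀ {n c} {f : Fin n → ℕ} → (∀ i → f i ≤ c) → sum f ≤ n * c
sum≤n*c {zero}  f≤c = z≤n
sum≤n*c {suc n} f≤c = +-mono-≤ (f≤c zero) (sum≤n*c (f≤c ∘ suc))

some-term≤average : ∀ {n c} (f : Fin (suc n) → ℕ) → sum f ≤ suc n * c → ∃ λ i → f i ≤ c
some-term≤average {zero}  {c} f ≤avg = zero , (begin
  f zero       ≡⟨ +-identityʳ _ ⟨
  f zero + 0   ≤⟨ ≤avg ⟩
  c + 0        ≡⟨ +-identityʳ c ⟩
  c            ∎)
  where open ≤-Reasoning
some-term≤average {suc n} {c} f ≤avg with f zero ≤? c
... | yes f₀≤c = zero , f₀≤c
... | no  f₀≰c with some-term≤average (f ∘ suc) rest≤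
  where
  rest≤ : sum (f ∘ suc) ≤ suc n * c
  rest≤ = ≮⇒≥ λ big → <⇒≱ (+-mono-< (≰⇒> f₀≰c) big) ≤avg
...   | i , fi≤c = suc i , fi≤c

sum-bounded-support : ∀ r {k} {P : ℕ → Set} (P? : ∀ s → Dec (P s)) →
                      (∀ s → P s → s < k) → sum {r} (λ i → 𝟙 (P? (toℕ i))) ≤ k
sum-bounded-support zero    P? P⇒< = z≤n
sum-bounded-support (suc r) {zero}  P? P⇒< =
  ≤-trans (sum≤n*c {suc r} (λ i → ≤-reflexive (𝟙-no (P? (toℕ i)) λ p → n≮0 (P⇒< _ p))))
          (≤-reflexive (*-zeroʳ r))
sum-bounded-support (suc r) {suc k} P? P⇒< =
  +-mono-≤ (𝟙≤1 (P? 0)) (sum-bounded-support r (P? ∘ suc) λ s p → ≤-pred (P⇒< (suc s) p))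

-- Non-members are dropped from the front until 0 is a member; then all members are below `M`.
sum-bounded-diameter : ∀ r {M} {P : ℕ → Set} (P? : ∀ s → Dec (P s)) →
                       (∀ s t → P s → P t → t < s + M) → sum {r} (λ i → 𝟙 (P? (toℕ i))) ≤ M
sum-bounded-diameter zero    P? diam = z≤n
sum-bounded-diameter (suc r) P? diam with P? 0
... | yes p₀ = 1+≤ (sum-bounded-support (suc r) P? λ t → diam 0 t p₀)
  where
  -- Matching on `P? 0` has turned its indicator in the goal into 1, while the support bound still
  -- has it unevaluated.
  1+≤ : ∀ {x M} → 𝟙 (P? 0) + x ≤ M → suc x ≤ M
  1+≤ = subst (λ z → z + _ ≤ _) (𝟙-yes (P? 0) p₀)
... | no  _  = sum-bounded-diameter r (P? ∘ suc) λ s t p q → ≤-pred (diam (suc s) (suc t) p q)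

-- The factor `c` serves the induction: shifting the index by one doubles it.
geometric-prefix : ∀ {J} k (c : ℕ) (b : Fin J → ℕ) → k ≤ J → (∀ i → toℕ i < k → b i ≡ 1) →
                   c * 2 ^ k ≤ c + sum (λ i → c * 2 ^ toℕ i * b i)
geometric-prefix zero    c b _ _ = ≤-trans (≤-reflexive (*-identityʳ c)) (m≤m+n c _)
geometric-prefix {suc J} (suc k) c b (s≤s k≤J) b≡1 = begin
  c * (2 * 2 ^ k)                                      ≡⟨ *-assoc c 2 (2 ^ k) ⟨
  c * 2 * 2 ^ k                                        ≤⟨ geometric-prefix k (c * 2) (b ∘ suc) k≤J (λ i i<k → b≡1 (suc i) (s≤s i<k)) ⟩
  c * 2 + sum (λ i → c * 2 * 2 ^ toℕ i * b (suc i))    ≡⟨ cong₂ _+_ c*2 (sum-cong-≗ λ i → cong (_* b (suc i)) (*-assoc c 2 (2 ^ toℕ i))) ⟩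
  c + c * 1 * b zero + sum (λ i → c * (2 * 2 ^ toℕ i) * b (suc i)) ≡⟨ +-assoc c _ _ ⟩
  c + (c * 1 * b zero + sum (λ i → c * (2 * 2 ^ toℕ i) * b (suc i))) ∎
  where
  open ≤-Reasoning
  double : ∀ c → c * 2 ≡ c + c * 1 * 1
  double = solve-∀
  c*2 : c * 2 ≡ c + c * 1 * b zero
  c*2 = trans (double c) (cong (λ z → c + c * 1 * z) (sym (b≡1 zero z<s)))

-- The embedding of ℕ in ℚ

private
  -- `ℕtoℚ` normalises its fraction, so its laws are checked on unnormalised fractions, where they
  -- are identities of integers.
  toℚᵘ-ℕtoℚ : ∀ k → toℚᵘ (ℕtoℚ k) ℚᵘ.≃ mkℚᵘ (ℤ.+ k) 0
  toℚᵘ-ℕtoℚ k = ℚ.toℚᵘ-fromℚᵘ (mkℚᵘ (ℤ.+ k) 0)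

ℕtoℚ-mono-≤ : ∀ {a b} → a ≤ b → ℕtoℚ a ℚ.≤ ℕtoℚ b
ℕtoℚ-mono-≤ {a} {b} a≤b = ℚ.toℚᵘ-cancel-≤
  (ℚᵘ.≤-respʳ-≃ (ℚᵘ.≃-sym {toℚᵘ (ℕtoℚ b)} (toℚᵘ-ℕtoℚ b))
  (ℚᵘ.≤-respˡ-≃ (ℚᵘ.≃-sym {toℚᵘ (ℕtoℚ a)} (toℚᵘ-ℕtoℚ a))
  (*≤* (ℤ.*-monoʳ-≤-nonNeg (ℤ.+ 1) (ℤ.+≤+ a≤b)))))

ℕtoℚ-cancel-< : ∀ {a b} → ℕtoℚ a ℚ.< ℕtoℚ b → a < b
ℕtoℚ-cancel-< a<b = ≰⇒> λ b≤a → ℚ.<-irrefl refl (ℚ.<-≤-trans a<b (ℕtoℚ-mono-≤ b≤a))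

ℕtoℚ-+ : ∀ a b → ℕtoℚ (a + b) ≡ ℕtoℚ a ℚ.+ ℕtoℚ b
ℕtoℚ-+ a b = ℚ.toℚᵘ-injective (begin
  toℚᵘ (ℕtoℚ (a + b))                    ≈⟨ toℚᵘ-ℕtoℚ (a + b) ⟩
  mkℚᵘ (ℤ.+ (a + b)) 0                     ≈⟨ *≡* (cong (ℤ._* ℤ.+ 1) (trans (ℤ.pos-+ a b) (sym (cong₂ ℤ._+_ (ℤ.*-identityʳ (ℤ.+ a)) (ℤ.*-identityʳ (ℤ.+ b)))))) ⟩
  mkℚᵘ (ℤ.+ a) 0 ℚᵘ.+ mkℚᵘ (ℤ.+ b) 0         ≈⟨ ℚᵘ.+-cong (ℚᵘ.≃-sym {toℚᵘ (ℕtoℚ a)} (toℚᵘ-ℕtoℚ a)) (ℚᵘ.≃-sym {toℚᵘ (ℕtoℚ b)} (toℚᵘ-ℕtoℚ b)) ⟩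
  toℚᵘ (ℕtoℚ a) ℚᵘ.+ toℚᵘ (ℕtoℚ b)       ≈⟨ ℚ.toℚᵘ-homo-+ (ℕtoℚ a) (ℕtoℚ b) ⟨
  toℚᵘ (ℕtoℚ a ℚ.+ ℕtoℚ b)               ∎)
  where open import Relation.Binary.Reasoning.Setoid ℚᵘ.≃-setoid

ℕtoℚ-* : ∀ a b → ℕtoℚ (a * b) ≡ ℕtoℚ a ℚ.* ℕtoℚ b
ℕtoℚ-* a b = ℚ.toℚᵘ-injective (begin
  toℚᵘ (ℕtoℚ (a * b))                    ≈⟨ toℚᵘ-ℕtoℚ (a * b) ⟩
  mkℚᵘ (ℤ.+ (a * b)) 0                     ≈⟨ *≡* (cong (ℤ._* ℤ.+ 1) (ℤ.pos-* a b)) ⟩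
  mkℚᵘ (ℤ.+ a) 0 ℚᵘ.* mkℚᵘ (ℤ.+ b) 0         ≈⟨ ℚᵘ.*-cong (ℚᵘ.≃-sym {toℚᵘ (ℕtoℚ a)} (toℚᵘ-ℕtoℚ a)) (ℚᵘ.≃-sym {toℚᵘ (ℕtoℚ b)} (toℚᵘ-ℕtoℚ b)) ⟩
  toℚᵘ (ℕtoℚ a) ℚᵘ.* toℚᵘ (ℕtoℚ b)       ≈⟨ ℚ.toℚᵘ-homo-* (ℕtoℚ a) (ℕtoℚ b) ⟨
  toℚᵘ (ℕtoℚ a ℚ.* ℕtoℚ b)               ∎)
  where open import Relation.Binary.Reasoning.Setoid ℚᵘ.≃-setoid

ℕtoℚ-nonNeg : ∀ k → ℚ.NonNegative (ℕtoℚ k)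
ℕtoℚ-nonNeg k = ℚ.nonNegative (ℕtoℚ-mono-≤ {0} {k} z≤n)

ℕtoℚ-pos : ∀ k .{{_ : NonZero k}} → ℚ.Positive (ℕtoℚ k)
ℕtoℚ-pos (suc k) = ℚ.positive (ℚ.<-≤-trans (ℚ.positive⁻¹ 1ℚ) (ℕtoℚ-mono-≤ {1} {suc k} (s≤s z≤n)))

square-cancel-≤ : ∀ {a b} → a * a < b * b → a ≤ b
square-cancel-≤ a²<b² = ≮⇒≥ λ b<a → <⇒≱ a²<b² (*-mono-≤ (<⇒≤ b<a) (<⇒≤ b<a))

-- If c·r² < x ≤ c·T² for r = a/(b+1), then r ≤ T, so 2^a is at most the (b+1)-st power of 2^T.
≤c*T²⇒LeCLog² : ∀ {x} c T {m} → x ℚ.≤ ℕtoℚ (c * (T * T)) → 2 ^ T ≤ m → LeCLog² x c m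
≤c*T²⇒LeCLog² {x} c T {m} x≤ 2^T≤m a b ca²< = begin
  2 ^ a            ≤⟨ ^-monoʳ-≤ 2 a≤ ⟩
  2 ^ (T * suc b)  ≡⟨ ^-*-assoc 2 T (suc b) ⟨
  (2 ^ T) ^ suc b  ≤⟨ ^-monoˡ-≤ (suc b) 2^T≤m ⟩
  m ^ suc b        ∎
  where
  open ≤-Reasoning
  rearrange : ∀ c T b → c * (T * T) * (b * b) ≡ c * ((T * b) * (T * b))
  rearrange = solve-∀
  ca²<′ : c * (a * a) < c * ((T * suc b) * (T * suc b))
  ca²<′ = subst (c * (a * a) <_) (rearrange c T (suc b))
    (ℕtoℚ-cancel-< (ℚ.<-≤-trans ca²< (subst (x ℚ.* ℕtoℚ (suc b * suc b) ℚ.≤_)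
      (sym (ℕtoℚ-* (c * (T * T)) (suc b * suc b)))
      (ℚ.*-monoʳ-≤-nonNeg (ℕtoℚ (suc b * suc b)) {{ℕtoℚ-nonNeg (suc b * suc b)}} x≤))))
  a≤ : a ≤ T * suc b
  a≤ = square-cancel-≤ (*-cancelˡ-< c _ _ ca²<′)

-- Finite subsets

module _ {n p} {P : Pred (Fin n) p} (P? : Decidable P) where

  subsetOf : Subset n
  subsetOf = tabulate (λ v → does (P? v))

  ∈-subsetOf⁺ : ∀ {v} → P v → v ∈ subsetOf
  ∈-subsetOf⁺ {v} pv = lookup⇒[]= v subsetOf (trans (lookup∘tabulate _ v) (dec-true (P? v) pv))

  ∈-subsetOf⁻ : ∀ {v} → v ∈ subsetOf → P v
  ∈-subsetOf⁻ {v} v∈ with P? v | trans (sym (lookup∘tabulate (λ v → does (P? v)) v)) ([]=⇒lookup v∈)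
  ... | yes pv | _ = pv
  ... | no  _  | ()

∣p∪q∣≤∣p∣+∣q∣ : ∀ {n} (p q : Subset n) → ∣ p ∪ q ∣ ≤ ∣ p ∣ + ∣ q ∣
∣p∪q∣≤∣p∣+∣q∣ []            []            = z≤n
∣p∪q∣≤∣p∣+∣q∣ (outside ∷ p) (outside ∷ q) = ∣p∪q∣≤∣p∣+∣q∣ p q
∣p∪q∣≤∣p∣+∣q∣ (outside ∷ p) (inside  ∷ q) =
  ≤-trans (s≤s (∣p∪q∣≤∣p∣+∣q∣ p q)) (≤-reflexive (sym (+-suc ∣ p ∣ ∣ q ∣)))
∣p∪q∣≤∣p∣+∣q∣ (inside  ∷ p) (outside ∷ q) = s≤s (∣p∪q∣≤∣p∣+∣q∣ p q)
∣p∪q∣≤∣p∣+∣q∣ (inside  ∷ p) (inside  ∷ q) =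
  s≤s (≤-trans (∣p∪q∣≤∣p∣+∣q∣ p q) (+-monoʳ-≤ ∣ p ∣ (n≤1+n ∣ q ∣)))

∣p∣≤length+∣q∣ : ∀ {n} (p q : Subset n) (xs : List (Fin n)) →
                 (∀ {v} → v ∈ p → v ∈ˡ xs ⊎ v ∈ q) → ∣ p ∣ ≤ length xs + ∣ q ∣
∣p∣≤length+∣q∣ {n} p q xs cover = begin
  ∣ p ∣                    ≤⟨ p⊆q⇒∣p∣≤∣q∣ (λ v∈p → x∈p∪q⁺ ([ (λ v∈xs → inj₁ (∈-fromList v∈xs)) , inj₂ ]′ (cover v∈p))) ⟩
  ∣ fromList xs ∪ q ∣      ≤⟨ ∣p∪q∣≤∣p∣+∣q∣ (fromList xs) q ⟩
  ∣ fromList xs ∣ + ∣ q ∣  ≤⟨ +-monoˡ-≤ ∣ q ∣ (∣fromList∣ xs) ⟩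
  length xs + ∣ q ∣        ∎
  where
  open ≤-Reasoning
  fromList : List (Fin n) → Subset n
  fromList []       = ⊥
  fromList (x ∷ xs) = ⁅ x ⁆ ∪ fromList xs
  ∈-fromList : ∀ {v xs} → v ∈ˡ xs → v ∈ fromList xs
  ∈-fromList {v} (here refl) = x∈p∪q⁺ (inj₁ (x∈⁅x⁆ v))
  ∈-fromList {xs = x ∷ _} (there v∈) = x∈p∪q⁺ {p = ⁅ x ⁆} (inj₂ (∈-fromList v∈))
  ∣fromList∣ : ∀ xs → ∣ fromList xs ∣ ≤ length xs
  ∣fromList∣ []       = ≤-reflexive (∣⊥∣≡0 n)
  ∣fromList∣ (x ∷ xs) = ≤-trans (∣p∪q∣≤∣p∣+∣q∣ ⁅ x ⁆ (fromList xs))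
                          (+-mono-≤ (≤-reflexive (∣⁅x⁆∣≡1 x)) (∣fromList∣ xs))

-- Turns a lower bound on a cardinality into an injection of the kind that `AtMost` forbids.
enumerate : ∀ {n} (p : Subset n) {k} → k ≤ ∣ p ∣ →
            ∃ λ (g : Fin k → Fin n) → Injective _≡_ _≡_ g × (∀ i → g i ∈ p)
enumerate p {zero} _ = (λ ()) , (λ { {()} }) , λ ()
enumerate (outside ∷ p) {suc k} k≤ with enumerate p k≤
... | g , g-inj , g∈ = suc ∘ g , g-inj ∘ Fin.suc-injective , λ i → Vec.there (g∈ i)
enumerate (inside ∷ p) {suc k} (s≤s k≤) with enumerate p k≤
... | g , g-inj , g∈ = g′ , g′-inj , g′∈
  where
  g′ : Fin (suc k) → Fin _
  g′ zero    = zero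
  g′ (suc i) = suc (g i)
  g′-inj : Injective _≡_ _≡_ g′
  g′-inj {zero}  {zero}  _  = refl
  g′-inj {suc i} {suc j} eq = cong suc (g-inj (Fin.suc-injective eq))
  g′∈ : ∀ i → g′ i ∈ inside ∷ p
  g′∈ zero    = Vec.here
  g′∈ (suc i) = Vec.there (g∈ i)

-- Walks and simple paths

module Walks {n : ℕ} (G : Graph n) where

  Adj-sym : ∀ {u v} → Adj G u v → Adj G v u
  Adj-sym {u} {v} uv = trans (Graph.sym G v u) uv

  Adj? : ∀ u v → Dec (Adj G u v)
  Adj? u v = adj G u v Bool.≟ true

  ∈-N⁻ : ∀ {v w} → w ∈ N G v → Adj G v w
  ∈-N⁻ {v} {w} w∈ = trans (sym (lookup∘tabulate (adj G v) w)) ([]=⇒lookup w∈)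

  -- Repeated vertices are allowed, so that rerouting is mere concatenation; the simple paths that
  -- `Separator` speaks of are extracted afterwards by `simplify`.
  Walk : Fin n → Fin n → Set
  Walk = Star (Adj G)

  vertices : ∀ {a b} → Walk a b → List (Fin n)
  vertices {a} ε       = a ∷ []
  vertices {a} (_ ◅ p) = a ∷ vertices p

  len : ∀ {a b} → Walk a b → ℕ
  len ε       = 0
  len (_ ◅ p) = suc (len p)

  len-◅◅ : ∀ {a b c} (p : Walk a b) (q : Walk b c) → len (p ◅◅ q) ≡ len p + len q
  len-◅◅ ε       q = refl
  len-◅◅ (_ ◅ p) q = cong suc (len-◅◅ p q)

  ∈-◅◅ : ∀ {a b c z} (p : Walk a b) (q : Walk b c) →
         z ∈ˡ vertices (p ◅◅ q) → z ∈ˡ vertices p ⊎ z ∈ˡ vertices q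
  ∈-◅◅ ε       q z∈         = inj₂ z∈
  ∈-◅◅ (_ ◅ p) q (here eq)  = inj₁ (here eq)
  ∈-◅◅ (_ ◅ p) q (there z∈) = [ inj₁ ∘ there , inj₂ ]′ (∈-◅◅ p q z∈)

  source∈ : ∀ {a b} (p : Walk a b) → a ∈ˡ vertices p
  source∈ ε       = here refl
  source∈ (_ ◅ _) = here refl

  target∈ : ∀ {a b} (p : Walk a b) → b ∈ˡ vertices p
  target∈ ε       = here refl
  target∈ (_ ◅ p) = there (target∈ p)

  record SimplePath (a b : Fin n) (Q : Fin n → Set) : Set where
    constructor simplePath
    field
      rest   : List (Fin n)
      last≡  : lastOf G a rest ≡ b
      linked : Linked (Adj G) (a ∷ rest)
      unique : Unique (a ∷ rest)
      all    : All Q (a ∷ rest)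

  private
    restart : ∀ {a b c Q} (S : SimplePath c b Q) → a ∈ˡ c ∷ SimplePath.rest S → SimplePath a b Q
    restart S (here refl) = S
    restart (simplePath (c ∷ rest) l≡ (_ ∷ lk) (_ ∷ un) (_ ∷ al)) (there a∈) =
      restart (simplePath rest l≡ lk un al) a∈

  -- If the start recurs on the simple path already found from its successor, `restart` cuts off the
  -- loop up to that recurrence.
  simplify : ∀ {a b} {Q : Fin n → Set} (p : Walk a b) → (∀ {z} → z ∈ˡ vertices p → Q z) → SimplePath a b Q
  simplify ε q = simplePath [] refl [-] ([] ∷ []) (q (here refl) ∷ [])
  simplify {a} (ac ◅ p) q with simplify p (q ∘ there)
  ... | S@(simplePath rest l≡ lk un al) with Any.any? (a Fin.≟_) (_ ∷ rest)
  ...   | yes a∈ = restart S a∈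
  ...   | no  a∉ = simplePath (_ ∷ rest) l≡ (ac ∷ lk) (¬Any⇒All¬ _ a∉ ∷ un) (q (here refl) ∷ al)

  module _ {P : Fin n → Set} (P? : Decidable P) where

    occurrences : ∀ {a b} → Walk a b → ℕ
    occurrences p = length (filter P? (vertices p))

    -- The last bound holds because the `len q` vertices after `y` are outside `P`, among
    -- `suc (len p)` vertices in all.
    last-occurrence : ∀ {a b} (p : Walk a b) → 1 ≤ occurrences p →
      ∃ λ y → P y × y ∈ˡ vertices p × Σ (Walk y b) λ q →
        (∀ {z} → z ∈ˡ vertices q → z ∈ˡ vertices p) × len q + occurrences p ≤ suc (len p)
    last-occurrence {a} ε 1≤ with P? a
    ... | yes pa = a , pa , here refl , ε , id , ≤-refl
    ... | no  _  = contradiction 1≤ λ ()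
    last-occurrence {a} (e ◅ p) 1≤ with 1 ≤? occurrences p
    last-occurrence {a} (e ◅ p) 1≤ | yes 1≤′ with last-occurrence p 1≤′ | P? a
    ... | y , py , y∈ , q , q⊆p , bound | yes _ =
          y , py , there y∈ , q , there ∘ q⊆p , subst (_≤ suc (suc (len p))) (sym (+-suc (len q) _)) (s≤s bound)
    ... | y , py , y∈ , q , q⊆p , bound | no  _ =
          y , py , there y∈ , q , there ∘ q⊆p , m≤n⇒m≤1+n bound
    last-occurrence {a} (e ◅ p) 1≤ | no ≮1 with P? a
    ... | yes pa = a , pa , here refl , e ◅ p , id ,
          ≤-trans (+-monoʳ-≤ (suc (len p)) (s≤s (≤-pred (≰⇒> ≮1)))) (≤-reflexive (+-comm (suc (len p)) 1))
    ... | no  _  = contradiction 1≤ ≮1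

    -- The vertices before the first occurrence `x` and after the last one `y` are outside `P`. The
    -- bound shows how long a section lies between `x` and `y`.
    outer-occurrences : ∀ {a b} (p : Walk a b) → 1 ≤ occurrences p →
      ∃ λ x → ∃ λ y → P x × P y × x ∈ˡ vertices p × y ∈ˡ vertices p ×
      Σ (Walk a x) λ q → Σ (Walk y b) λ q′ →
        (∀ {z} → z ∈ˡ vertices q → z ∈ˡ vertices p) × (∀ {z} → z ∈ˡ vertices q′ → z ∈ˡ vertices p) ×
        len q + len q′ + occurrences p ≤ suc (len p)
    outer-occurrences {a} p 1≤ with P? a
    ... | yes pa with last-occurrence p 1≤
    ...   | y , py , y∈ , q′ , q′⊆p , bound =
            a , y , pa , py , source∈ p , y∈ , ε , q′ , (λ { (here refl) → source∈ p }) , q′⊆p , bound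
    outer-occurrences {a} ε 1≤ | no ¬pa with P? a
    ... | yes pa = contradiction pa ¬pa
    ... | no  _  = contradiction 1≤ λ ()
    outer-occurrences {a} (e ◅ p) 1≤ | no ¬pa with P? a
    ... | yes pa = contradiction pa ¬pa
    ... | no  _  with outer-occurrences p 1≤
    ...   | x , y , px , py , x∈ , y∈ , q , q′ , q⊆p , q′⊆p , bound =
            x , y , px , py , there x∈ , there y∈ , e ◅ q , q′ ,
            (λ { (here eq) → here eq ; (there z∈) → there (q⊆p z∈) }) , there ∘ q′⊆p , s≤s bound

  -- Members of the layered family and rerouting through their sources

  module Family {m : ℕ} (ℓ : Fin n → Fin m) where
    open Layered G ℓ

    Arc? : ∀ u v → Dec (Arc u v)
    Arc? u v = Adj? u v ×-dec (ℓ v Fin.<? ℓ u)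

    Source? : Decidable Source
    Source? u = Fin.all? λ w → ¬? (Arc? w u)

    Reach-trans : ∀ {u v w} → Reach u v → Reach v w → Reach u w
    Reach-trans here         r = r
    Reach-trans (there a r′) r = there a (Reach-trans r′ r)

    -- Arcs strictly lower the layer, so the layer index of `u` bounds the depth of the search.
    Reach? : ∀ u v → Dec (Reach u v)
    Reach? u v = go (suc (toℕ (ℓ u))) u ≤-refl
      where
      go : ∀ k u → toℕ (ℓ u) < k → Dec (Reach u v)
      next? : ∀ k u → toℕ (ℓ u) < suc k → ∀ w → Dec (Arc u w × Reach w v)
      next? k u ℓu<k w with Arc? u w
      ... | no ¬a = no (¬a ∘ proj₁)
      ... | yes a@(_ , ℓw<ℓu) = map′ (a ,_) proj₂ (go k w (<-≤-trans ℓw<ℓu (≤-pred ℓu<k)))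
      go (suc k) u ℓu<k = map′
        [ (λ { refl → here }) , (λ { (_ , a , r) → there a r }) ]′
        (λ { here → inj₁ refl ; (there a r) → inj₂ (_ , a , r) })
        ((u Fin.≟ v) ⊎-dec Fin.any? (next? k u ℓu<k))

    -- Climbing along in-arcs strictly raises the layer, which stays below `m`, so the climb ends at
    -- a source.
    source-above : ∀ v → ∃ λ u → Source u × Reach u v
    source-above v = go m v here (m≤n+m m (toℕ (ℓ v)))
      where
      go : ∀ k u → Reach u v → m ≤ toℕ (ℓ u) + k → ∃ λ u → Source u × Reach u v
      go zero    u r m≤ = contradiction (subst (m ≤_) (+-identityʳ _) m≤) (<⇒≱ (Fin.toℕ<n (ℓ u)))
      go (suc k) u r m≤ with Fin.any? (λ w → Arc? w u)
      ... | no ¬a = u , (λ w a → ¬a (w , a)) , r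
      ... | yes (w , a@(_ , ℓu<ℓw)) =
            go k w (there a r) (≤-trans m≤ (≤-trans (≤-reflexive (+-suc _ k)) (+-monoˡ-≤ k ℓu<ℓw)))

    depth : ∀ {u v} → Reach u v → ℕ
    depth here        = 0
    depth (there _ r) = suc (depth r)

    private
      -- Past its end the path stays at its last vertex; layers are compared only up to index
      -- `depth r`.
      at : ∀ {u v} → Reach u v → ℕ → Fin n
      at {u} _           zero    = u
      at {u} here        (suc _) = u
      at     (there _ r) (suc i) = at r i

      at-reach : ∀ {u v} (r : Reach u v) i → Reach u (at r i)
      at-reach here        zero    = here
      at-reach (there _ _) zero    = here
      at-reach here        (suc _) = here
      at-reach (there a r) (suc i) = there a (at-reach r i)

      at-descends : ∀ {u v} (r : Reach u v) i j → i < j → j ≤ depth r → ℓ (at r j) Fin.< ℓ (at r i)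
      at-descends (there (_ , lt) here) zero (suc zero) _ _ = lt
      at-descends (there (_ , lt) (there _ _)) zero (suc zero) _ _ = lt
      at-descends (there (_ , lt) r) zero (suc (suc j)) _ (s≤s j≤) =
        <-trans (at-descends r 0 (suc j) z<s j≤) lt
      at-descends (there _ r) (suc i) (suc j) (s≤s i<j) (s≤s j≤) = at-descends r i j i<j j≤

    -- Layers strictly decrease along arcs, so a directed path from a source meets
    -- as many layers as it has vertices.
    depth<thickness : ∀ {T u v} → ThicknessAtMost T → Source u → (r : Reach u v) → depth r < T
    depth<thickness {T} {u} thick src r = ≰⇒> λ T≤ → thick u src layer (layer-injective T≤)
      λ i → at r (toℕ i) , at-reach r (toℕ i) , refl
      where
      layer : Fin (suc T) → Fin m
      layer i = ℓ (at r (toℕ i))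
      layer-injective : T ≤ depth r → Injective _≡_ _≡_ layer
      layer-injective T≤ {i} {j} eq with <-cmp (toℕ i) (toℕ j)
      ... | tri< i<j _ _ = contradiction (cong toℕ (sym eq)) (<⇒≢ (at-descends r _ _ i<j (≤-trans (Fin.toℕ≤pred[n] j) T≤)))
      ... | tri≈ _ i≡j _ = Fin.toℕ-injective i≡j
      ... | tri> _ _ j<i = contradiction (cong toℕ eq) (<⇒≢ (at-descends r _ _ j<i (≤-trans (Fin.toℕ≤pred[n] i) T≤)))

    down : ∀ {u v} (r : Reach u v) → Σ (Walk u v) λ p →
           len p ≡ depth r × (∀ {z} → z ∈ˡ vertices p → Reach z v)
    down here = ε , refl , λ { (here refl) → here }
    down (there a r) with down r
    ... | p , len≡ , above = proj₁ a ◅ p , cong suc len≡ , λ { (here refl) → there a r ; (there z∈) → above z∈ }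

    up : ∀ {u v} (r : Reach u v) → Σ (Walk v u) λ p →
         len p ≡ depth r × (∀ {z} → z ∈ˡ vertices p → Reach z v)
    up here = ε , refl , λ { (here refl) → here }
    up {u} {v} (there {w = w} a r) with up r
    ... | p , len≡ , above = p ◅◅ last , trans (len-◅◅ p last) (trans (+-comm _ 1) (cong suc len≡)) ,
          [ above , (λ { (here refl) → r ; (there (here refl)) → there a r }) ]′ ∘ ∈-◅◅ p last
      where
      last : Walk w u
      last = Adj-sym (proj₁ a) ◅ ε

    -- A member containing `z` contains its descendant `z′`, so every member met by `ys` is met by
    -- `xs`.
    Dominates : List (Fin n) → List (Fin n) → Set
    Dominates xs ys = ∀ {z} → z ∈ˡ ys → ∃ λ z′ → z′ ∈ˡ xs × Reach z z′

    Thin : ℕ → ∀ {a b} → Walk a b → Set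
    Thin T p = ∀ u → Source u → occurrences (Reach? u) p ≤ 2 * T

    -- Rerouting the part of a walk between its first and last vertex in the member below u
    -- through u only uses ancestors of these two vertices, hence meets no new member.
    thin : ∀ {T a b} → ThicknessAtMost T → (p : Walk a b) →
           Σ (Walk a b) λ q → Thin T q × Dominates (vertices p) (vertices q)
    thin {T} {a} {b} thick p = go (suc (len p)) p ≤-refl
      where
      -- Rerouting is repeated while some member is met too often; the length drops each time, and
      -- `k` exceeds it.
      go : ∀ k (p : Walk a b) → len p < k → Σ (Walk a b) λ q → Thin T q × Dominates (vertices p) (vertices q)
      go (suc k) p (s≤s len≤k) with Fin.any? (λ u → Source? u ×-dec (2 * T <? occurrences (Reach? u) p))
      ... | no ¬fat = p , (λ u src → ≮⇒≥ λ fat → ¬fat (u , src , fat)) , λ z∈ → _ , z∈ , here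
      ... | yes (u , src , fat) with outer-occurrences (Reach? u) p (≤-trans (s≤s z≤n) fat)
      ...   | x , y , ux , uy , x∈ , y∈ , q , q′ , q⊆p , q′⊆p , bound
            with up ux | down uy
      ...   | p↑ , len↑ , above↑ | p↓ , len↓ , above↓
            with go k (q ◅◅ p↑ ◅◅ p↓ ◅◅ q′) shorter
        where
        open ≤-Reasoning
        occ = occurrences (Reach? u) p
        regroup : len (q ◅◅ p↑ ◅◅ p↓ ◅◅ q′) ≡ len q + len q′ + (depth ux + depth uy)
        regroup = trans (len-◅◅ q _) (trans (cong (len q +_) (trans (len-◅◅ p↑ _)
                    (cong₂ _+_ len↑ (trans (len-◅◅ p↓ q′) (cong (_+ len q′) len↓)))))
                    (rearrange (len q) (depth ux) (depth uy) (len q′)))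
          where
          rearrange : ∀ a b c d → a + (b + (c + d)) ≡ a + d + (b + c)
          rearrange = solve-∀
        2+depths≤2T : suc (suc (depth ux + depth uy)) ≤ 2 * T
        2+depths≤2T = begin
          suc (suc (depth ux + depth uy))     ≡⟨ cong suc (+-suc (depth ux) (depth uy)) ⟨
          suc (depth ux) + suc (depth uy)     ≤⟨ +-mono-≤ (depth<thickness thick src ux) (depth<thickness thick src uy) ⟩
          T + T                               ≡⟨ cong (T +_) (+-identityʳ T) ⟨
          2 * T                               ∎
        -- The section cut out has at least `occ` - 1 ≥ 2T edges, the detour through `u` at most 2T
        -- - 2.
        shorter : len (q ◅◅ p↑ ◅◅ p↓ ◅◅ q′) < k
        shorter = ≤-trans (≤-pred (begin
          suc (suc (len (q ◅◅ p↑ ◅◅ p↓ ◅◅ q′)))                ≡⟨ cong (2 +_) regroup ⟩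
          suc (suc (len q + len q′ + (depth ux + depth uy)))   ≡⟨ trans (+-suc (len q + len q′) _) (cong suc (+-suc (len q + len q′) _)) ⟨
          len q + len q′ + suc (suc (depth ux + depth uy))     ≤⟨ +-monoʳ-≤ (len q + len q′) (≤-trans 2+depths≤2T (<⇒≤ fat)) ⟩
          len q + len q′ + occ                                 ≤⟨ bound ⟩
          suc (len p)                                          ∎)) len≤k
      ...   | r , r-thin , r-dom = r , r-thin , λ z∈ → pull (r-dom z∈)
        where
        locate : ∀ {z} → z ∈ˡ vertices (q ◅◅ p↑ ◅◅ p↓ ◅◅ q′) → ∃ λ z′ → z′ ∈ˡ vertices p × Reach z z′
        locate z∈ with ∈-◅◅ q _ z∈
        ... | inj₁ z∈q = _ , q⊆p z∈q , here
        ... | inj₂ z∈₁ with ∈-◅◅ p↑ _ z∈₁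
        ...   | inj₁ z∈p↑ = _ , x∈ , above↑ z∈p↑
        ...   | inj₂ z∈₂ with ∈-◅◅ p↓ q′ z∈₂
        ...     | inj₁ z∈p↓ = _ , y∈ , above↓ z∈p↓
        ...     | inj₂ z∈q′ = _ , q′⊆p z∈q′ , here
        pull : ∀ {z} → (∃ λ z′ → z′ ∈ˡ vertices (q ◅◅ p↑ ◅◅ p↓ ◅◅ q′) × Reach z z′) →
               ∃ λ z′ → z′ ∈ˡ vertices p × Reach z z′
        pull (z′ , z′∈ , zz′) with locate z′∈
        ... | z″ , z″∈ , z′z″ = z″ , z″∈ , Reach-trans zz′ z′z″

-- Fractional covers from integer weights

sum-map-tabulate : ∀ {n N} (k : Fin N → ℕ) (g : Fin n → Fin N) →
                   sumˡ (map k (List.tabulate g)) ≡ sum (k ∘ g)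
sum-map-tabulate {zero}  k g = refl
sum-map-tabulate {suc n} k g = cong (k (g zero) +_) (sum-map-tabulate k (g ∘ suc))

sum-map-filter : ∀ {n N} {P : Fin N → Set} (P? : Decidable P) (k : Fin N → ℕ) (g : Fin n → Fin N) →
                 sumˡ (map k (filter P? (List.tabulate g))) ≡ sum (λ i → 𝟙 (P? (g i)) * k (g i))
sum-map-filter {zero}  P? k g = refl
sum-map-filter {suc n} P? k g with P? (g zero)
... | yes _ = cong₂ _+_ (sym (+-identityʳ (k (g zero)))) (sum-map-filter P? k (g ∘ suc))
... | no  _ = sum-map-filter P? k (g ∘ suc)

module Covering {n : ℕ} (G : Graph n) {m : ℕ} (ℓ : Fin n → Fin m) where
  open Layered G ℓ
  open Walks G
  open Family ℓ

  -- A source u stands for the member {v | Reach u v} of the family.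
  _∋_ : Fin n → Fin n → Set
  u ∋ v = Source u × Reach u v

  _∋?_ : ∀ u v → Dec (u ∋ v)
  u ∋? v = Source? u ×-dec Reach? u v

  Hits : Fin n → List (Fin n) → Set
  Hits u xs = Any (u ∋_) xs

  Hits? : ∀ u xs → Dec (Hits u xs)
  Hits? u xs = Any.any? (u ∋?_) xs

  module _ (D : ℕ) .{{_ : NonZero D}} (k : Fin n → ℕ) where

    private
      instance
        D≢0 : ℚ.NonZero (ℕtoℚ D)
        D≢0 = ℚ.pos⇒nonZero (ℕtoℚ D) {{ℕtoℚ-pos D}}

      1/D : ℚ
      1/D = ℚ.1/ ℕtoℚ D

      instance
        1/D-nonNeg : ℚ.NonNegative 1/D
        1/D-nonNeg = ℚ.pos⇒nonNeg 1/D {{ℚ.1/pos⇒pos (ℕtoℚ D) {{ℕtoℚ-pos D}}}}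

    -- All estimates stay in ℕ: a cover is given by integer numerators over the common denominator
    -- `D`.
    scaled : Fin n → ℚ
    scaled u = ℕtoℚ (k u) ℚ.* 1/D

    private
      sumℚ-scaled : ∀ us → sumℚ (map scaled us) ≡ ℕtoℚ (sumˡ (map k us)) ℚ.* 1/D
      sumℚ-scaled []       = sym (ℚ.*-zeroˡ 1/D)
      sumℚ-scaled (u ∷ us) = begin
        scaled u ℚ.+ sumℚ (map scaled us)                            ≡⟨ cong (scaled u ℚ.+_) (sumℚ-scaled us) ⟩
        scaled u ℚ.+ ℕtoℚ (sumˡ (map k us)) ℚ.* 1/D              ≡⟨ ℚ.*-distribʳ-+ 1/D (ℕtoℚ (k u)) _ ⟨
        (ℕtoℚ (k u) ℚ.+ ℕtoℚ (sumˡ (map k us))) ℚ.* 1/D          ≡⟨ cong (ℚ._* 1/D) (ℕtoℚ-+ (k u) (sumˡ (map k us))) ⟨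
        ℕtoℚ (k u + sumˡ (map k us)) ℚ.* 1/D                     ∎
        where open ≡-Reasoning

    scaled-fracCover : ∀ S → (∀ v → v ∈ S → D ≤ sum (λ u → 𝟙 (u ∋? v) * k u)) → FracCover S scaled
    scaled-fracCover S D≤ = nonNeg , covered
      where
      nonNeg : ∀ u → 0ℚ ℚ.≤ scaled u
      nonNeg u = subst (ℚ._≤ scaled u) (ℚ.*-zeroˡ 1/D)
        (ℚ.*-monoʳ-≤-nonNeg 1/D (ℕtoℚ-mono-≤ {0} {k u} z≤n))
      covered : ∀ v → v ∈ S → _
      covered v v∈S = us , Unique.filter⁺ (_∋? v) (Unique.allFin⁺ n) , all-filter (_∋? v) (allFin n) , 1≤
        where
        open ℚ.≤-Reasoning
        us = filter (_∋? v) (allFin n)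
        1≤ : 1ℚ ℚ.≤ sumℚ (map scaled us)
        1≤ = begin
          1ℚ                                                     ≡⟨ ℚ.*-inverseʳ (ℕtoℚ D) ⟨
          ℕtoℚ D ℚ.* 1/D                                         ≤⟨ ℚ.*-monoʳ-≤-nonNeg 1/D (ℕtoℚ-mono-≤ (D≤ v v∈S)) ⟩
          ℕtoℚ (sum (λ u → 𝟙 (u ∋? v) * k u)) ℚ.* 1/D           ≡⟨ cong (λ z → ℕtoℚ z ℚ.* 1/D) (sum-map-filter (_∋? v) k id) ⟨
          ℕtoℚ (sumˡ (map k us)) ℚ.* 1/D                     ≡⟨ sumℚ-scaled us ⟨
          sumℚ (map scaled us)                                   ∎

    totalWeight-scaled : ∀ q → sum k ≤ q * D → totalWeight scaled ℚ.≤ ℕtoℚ q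
    totalWeight-scaled q sum≤ = begin
      totalWeight scaled                       ≡⟨ sumℚ-scaled (allFin n) ⟩
      ℕtoℚ (sumˡ (map k (allFin n))) ℚ.* 1/D ≡⟨ cong (λ z → ℕtoℚ z ℚ.* 1/D) (sum-map-tabulate k id) ⟩
      ℕtoℚ (sum k) ℚ.* 1/D                     ≤⟨ ℚ.*-monoʳ-≤-nonNeg 1/D (ℕtoℚ-mono-≤ sum≤) ⟩
      ℕtoℚ (q * D) ℚ.* 1/D                     ≡⟨ cong (ℚ._* 1/D) (ℕtoℚ-* q D) ⟩
      ℕtoℚ q ℚ.* ℕtoℚ D ℚ.* 1/D                ≡⟨ ℚ.*-assoc (ℕtoℚ q) (ℕtoℚ D) 1/D ⟩
      ℕtoℚ q ℚ.* (ℕtoℚ D ℚ.* 1/D)              ≡⟨ cong (ℕtoℚ q ℚ.*_) (ℚ.*-inverseʳ (ℕtoℚ D)) ⟩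
      ℕtoℚ q ℚ.* 1ℚ                            ≡⟨ ℚ.*-identityʳ (ℕtoℚ q) ⟩
      ℕtoℚ q                                   ∎
      where open ℚ.≤-Reasoning

  -- Balls around B when vertices are charged their cost

  module Weighted (w : Fin n → ℕ) (1≤w : ∀ u → 1 ≤ w u) (B : Subset n) where

    X : Fin n → ℕ
    X v = sum λ u → 𝟙 (u ∋? v) * w u

    -- Non-sources are counted too; this can only enlarge `W`, and gives `W` = n when all weights
    -- are 1.
    W : ℕ
    W = sum w

    hitWeight : List (Fin n) → ℕ
    hitWeight xs = sum λ u → 𝟙 (Hits? u xs) * w u

    1≤X : ∀ v → 1 ≤ X v
    1≤X v with source-above v
    ... | u , u∋v = ≤-trans (subst (λ z → 1 ≤ z * w u) (sym (𝟙-yes (u ∋? v) u∋v)) (≤-trans (1≤w u) (≤-reflexive (sym (+-identityʳ _)))))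
                            (term≤sum (λ u → 𝟙 (u ∋? v) * w u) u)

    X≤W : ∀ v → X v ≤ W
    X≤W v = sum-mono λ u → ≤-trans (*-monoˡ-≤ (w u) (𝟙≤1 (u ∋? v))) (≤-reflexive (+-identityʳ (w u)))

    X-mono : ∀ {z v} → Reach z v → X z ≤ X v
    X-mono {z} {v} zv = sum-mono λ u → *-monoˡ-≤ (w u)
      (𝟙-mono (u ∋? z) (u ∋? v) λ (src , uz) → src , Reach-trans uz zv)

    hitWeight-dominated : ∀ {xs ys} → Dominates xs ys → hitWeight ys ≤ hitWeight xs
    hitWeight-dominated {xs} {ys} dom = sum-mono λ u → *-monoˡ-≤ (w u) (𝟙-mono (Hits? u ys) (Hits? u xs) λ hit →
      let z , z∈ys , src , uz = find hit
          z′ , z′∈xs , zz′    = dom z∈ys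
      in lose z′∈xs (src , Reach-trans uz zz′))

    hitWeight-[_] : ∀ v → hitWeight (v ∷ []) ≤ X v
    hitWeight-[ v ] = sum-mono λ u → *-monoˡ-≤ (w u) (𝟙-mono (Hits? u (v ∷ [])) (u ∋? v) λ { (here u∋v) → u∋v })

    hitWeight-∷ : ∀ v xs → hitWeight (v ∷ xs) ≤ X v + hitWeight xs
    hitWeight-∷ v xs = ≤-trans (sum-mono λ u →
        ≤-trans (*-monoˡ-≤ (w u) (union u)) (≤-reflexive (*-distribʳ-+ (w u) (𝟙 (u ∋? v)) _)))
      (≤-reflexive (∑-distrib-+ (λ u → 𝟙 (u ∋? v) * w u) (λ u → 𝟙 (Hits? u xs) * w u)))
      where
      union : ∀ u → 𝟙 (Hits? u (v ∷ xs)) ≤ 𝟙 (u ∋? v) + 𝟙 (Hits? u xs)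
      union u = 𝟙-⊎ (Hits? u (v ∷ xs)) (u ∋? v) (Hits? u xs) Any.toSum

    -- The ball of radius `s` around `B`: some walk from `v` to `B` has vertex costs, both ends
    -- included, of sum at most `s`.
    data Near (s : ℕ) (v : Fin n) : Set where
      stop : v ∈ B → X v ≤ s → Near s v
      step : ∀ {t u} → Adj G v u → Near t u → t + X v ≤ s → Near s v

    Near-mono : ∀ {s t v} → s ≤ t → Near s v → Near t v
    Near-mono s≤t (stop v∈B Xv≤s)   = stop v∈B (≤-trans Xv≤s s≤t)
    Near-mono s≤t (step vu near t+) = step vu near (≤-trans t+ s≤t)

    -- Costs are at least 1, so the remaining radius strictly drops; by `Near-mono` only the largest
    -- possible remainder `s ∸ X v` has to be tried.
    Near? : ∀ s v → Dec (Near s v)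
    Near? s v = go (suc s) s v ≤-refl
      where
      go : ∀ k s v → s < k → Dec (Near s v)
      go (suc k) s v (s≤s s≤k) with X v ≤? s
      ... | no Xv≰s = no λ { (stop _ Xv≤s) → Xv≰s Xv≤s ; (step {t} _ _ t+) → Xv≰s (≤-trans (m≤n+m (X v) t) t+) }
      ... | yes Xv≤s = map′
        [ (λ v∈B → stop v∈B Xv≤s) , (λ (u , vu , near) → step vu near (≤-reflexive (m∸n+n≡m Xv≤s))) ]′
        (λ { (stop v∈B _) → inj₁ v∈B
           ; (step {t} {u} vu near t+) → inj₂ (u , vu , Near-mono (subst (_≤ s ∸ X v) (m+n∸n≡m t (X v)) (∸-monoˡ-≤ (X v) t+)) near) })
        ((v ∈? B) ⊎-dec Fin.any? λ u → Adj? v u ×-dec go k (s ∸ X v) u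
          (<-≤-trans (∸-monoʳ-< {o = 0} (1≤X v) Xv≤s) s≤k))

    -- A member that meets the walk in several vertices is charged for each of them in `Near` but
    -- only once in `hitWeight`.
    Near⇒walk : ∀ {s v} → Near s v → ∃ λ b → b ∈ B × Σ (Walk v b) λ p → hitWeight (vertices p) ≤ s
    Near⇒walk {s} {v} (stop v∈B Xv≤s) = v , v∈B , ε , ≤-trans hitWeight-[ v ] Xv≤s
    Near⇒walk {s} {v} (step {t} vu near t+) with Near⇒walk near
    ... | b , b∈B , p , hw≤ = b , b∈B , vu ◅ p ,
          ≤-trans (hitWeight-∷ v (vertices p)) (≤-trans (≤-trans (+-monoʳ-≤ (X v) hw≤) (≤-reflexive (+-comm (X v) t))) t+)

    -- Each of the `depth r` vertices added is an ancestor of `v`, hence costs at most `X v`.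
    Near-up : ∀ {s u v} (r : Reach u v) → Near s v → Near (s + depth r * X v) u
    Near-up {s} here near = Near-mono (m≤m+n s 0) near
    Near-up {s} {u} {v} (there {w = w′} a r) near =
      step (proj₁ a) (Near-up r near) (begin
        s + depth r * X v + X u   ≤⟨ +-monoʳ-≤ (s + depth r * X v) (X-mono (there a r)) ⟩
        s + depth r * X v + X v   ≡⟨ rearrange s (depth r) (X v) ⟩
        s + suc (depth r) * X v   ∎)
      where
      open ≤-Reasoning
      rearrange : ∀ s d x → s + d * x + x ≡ s + suc d * x
      rearrange = solve-∀

    Near-down : ∀ {s u v} (r : Reach u v) → Near s u → Near (s + depth r * X v) v
    Near-down {s} here near = Near-mono (m≤m+n s 0) near
    Near-down {s} {u} {v} (there {w = w′} a r) near =
      Near-mono (begin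
        s + X w′ + depth r * X v   ≤⟨ +-monoˡ-≤ (depth r * X v) (+-monoʳ-≤ s (X-mono r)) ⟩
        s + X v + depth r * X v    ≡⟨ +-assoc s (X v) _ ⟩
        s + suc (depth r) * X v    ∎)
        (Near-down r (step (Adj-sym (proj₁ a)) near ≤-refl))
      where open ≤-Reasoning

    -- The case `v ∈ B` is that of a vertex of `B` whose own cost exceeds `s`: a walk can end there
    -- without entering the ball.
    Boundary : ℕ → Fin n → Set
    Boundary s v = ¬ Near s v × (v ∈ B ⊎ ∃ λ u → Adj G v u × Near s u)

    Boundary? : ∀ s → Decidable (Boundary s)
    Boundary? s v = ¬? (Near? s v) ×-dec ((v ∈? B) ⊎-dec Fin.any? λ u → Adj? v u ×-dec Near? s u)

    Boundary⇒Near : ∀ {s v} → Boundary s v → Near (s + X v) v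
    Boundary⇒Near {s} {v} (_ , inj₁ v∈B)             = stop v∈B (m≤n+m (X v) s)
    Boundary⇒Near         (_ , inj₂ (u , vu , near)) = step vu near ≤-refl

    boundary : ℕ → Subset n
    boundary s = subsetOf (Boundary? s)

    -- A walk starting outside the ball has a boundary vertex just before it first enters the ball,
    -- or at its end in `B` if it never does.
    boundary-separates : ∀ {s A} → (∀ a → a ∈ A → ¬ Near s a) → Separator G ⊤ A B (boundary s)
    boundary-separates {s} far a ps a∈A last∈B linked _ _ = go a ps (far a a∈A) last∈B linked
      where
      go : ∀ a ps → ¬ Near s a → lastOf G a ps ∈ B → Linked (Adj G) (a ∷ ps) → Any (_∈ boundary s) (a ∷ ps)
      go a []       ¬near a∈B    _         = here (∈-subsetOf⁺ (Boundary? s) (¬near , inj₁ a∈B))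
      go a (p ∷ ps) ¬near last∈B (ap ∷ lk) with Near? s p
      ... | yes near = here (∈-subsetOf⁺ (Boundary? s) (¬near , inj₂ (p , ap , near)))
      ... | no ¬near′ = there (go p ps ¬near′ last∈B lk)

    -- Rounding to a cheap separator by averaging over radii

    module Rounding (T J : ℕ) (thick : ThicknessAtMost T) (W≤2^J : W ≤ 2 ^ J) where

      -- At scale 0 the threshold exceeds every cost, so the member just has to meet the boundary;
      -- each further scale halves it.
      Active : ℕ → ℕ → Fin n → Set
      Active i s u = ∃ λ v → u ∋ v × Boundary s v × X v < 2 ^ (suc J ∸ i)

      Active? : ∀ i s u → Dec (Active i s u)
      Active? i s u = Fin.any? λ v → (u ∋? v) ×-dec Boundary? s v ×-dec (X v <? 2 ^ (suc J ∸ i))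

      -- Two light vertices of one member are joined through its source by a walk of
      -- fewer than 2T vertices none of which is heavier than the heavier end.
      active-diameter : ∀ {i u} s t → Active i s u → Active i t u → t < s + 2 * T * 2 ^ (suc J ∸ i)
      -- If t were at least s + 2Tθ, the walk from `v′` through `u` to `v` and on into the ball
      -- would make `v′` near at radius t.
      active-diameter {i} {u} s t (v , (src , uv) , bv , v<θ) (v′ , (_ , uv′) , (¬near , _) , v′<θ) = ≰⇒> λ far →
        ¬near (Near-mono (≤-trans bound far) (Near-down uv′ (Near-up uv (Boundary⇒Near bv))))
        where
        open ≤-Reasoning
        θ = 2 ^ (suc J ∸ i)
        rearrange : ∀ s d x y → s + x + d * x + y ≡ s + (suc d * x + y)
        rearrange = solve-∀
        double : ∀ T θ → T * θ + T * θ ≡ 2 * T * θ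
        double = solve-∀
        bound : s + X v + depth uv * X v + depth uv′ * X v′ ≤ s + 2 * T * θ
        bound = begin
          s + X v + depth uv * X v + depth uv′ * X v′   ≡⟨ rearrange s (depth uv) (X v) _ ⟩
          s + (suc (depth uv) * X v + depth uv′ * X v′) ≤⟨ +-monoʳ-≤ s (+-mono-≤
                                                             (*-mono-≤ (depth<thickness thick src uv) (<⇒≤ v<θ))
                                                             (*-mono-≤ (<⇒≤ (depth<thickness thick src uv′)) (<⇒≤ v′<θ))) ⟩
          s + (T * θ + T * θ)                           ≡⟨ cong (s +_) (double T θ) ⟩
          s + 2 * T * θ                                 ∎

      -- As 1 + Σ_{i<k} 2^i = 2^k, this is at least 2^J / X v for each v of the member on the boundary.
      coeff : ℕ → Fin n → ℕ
      coeff s u = 𝟙 (Active? 0 s u) + sum {J} (λ i → 2 ^ toℕ i * 𝟙 (Active? (suc (toℕ i)) s u))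

      -- This is 2^J times the total weight of the cover for radius `s`.
      cost : ℕ → ℕ
      cost s = sum λ u → w u * coeff s u

      -- Let J - k be the integer part of log₂ of `X v`. The members containing `v` are active at
      -- scales 0 to k, so their coefficients are at least 2^k, and 2^k · `X v` ≥ 2^J.
      boundary-covered : ∀ s v → v ∈ boundary s → 2 ^ J ≤ sum (λ u → 𝟙 (u ∋? v) * (w u * coeff s u))
      boundary-covered s v v∈S with dyadic-scale J (X v) (1≤X v) (≤-<-trans (≤-trans (X≤W v) W≤2^J) (^-monoʳ-< 2 (s≤s (s≤s z≤n)) (n<1+n J)))
      ... | k , k≤J , 2^J≤ , Xv< = begin
        2 ^ J                                              ≤⟨ 2^J≤ ⟩
        2 ^ k * X v                                        ≡⟨ *-distribˡ-sum (2 ^ k) (λ u → 𝟙 (u ∋? v) * w u) ⟩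
        sum (λ u → 2 ^ k * (𝟙 (u ∋? v) * w u))             ≤⟨ sum-mono termwise ⟩
        sum (λ u → 𝟙 (u ∋? v) * (w u * coeff s u))         ∎
        where
        open ≤-Reasoning
        active : ∀ {u} → u ∋ v → ∀ i → i ≤ k → 𝟙 (Active? i s u) ≡ 1
        active u∋v i i≤k = 𝟙-yes (Active? i s _) (v , u∋v , ∈-subsetOf⁻ (Boundary? s) v∈S ,
          <-≤-trans Xv< (^-monoʳ-≤ 2 (∸-monoʳ-≤ (suc J) i≤k)))
        2^k≤coeff : ∀ {u} → u ∋ v → 2 ^ k ≤ coeff s u
        2^k≤coeff {u} u∋v = begin
          2 ^ k                                        ≡⟨ +-identityʳ (2 ^ k) ⟨
          1 * 2 ^ k                                    ≤⟨ geometric-prefix {J} k 1 (λ i → 𝟙 (Active? (suc (toℕ i)) s u)) k≤J (λ i i<k → active u∋v (suc (toℕ i)) i<k) ⟩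
          1 + sum {J} (λ i → 1 * 2 ^ toℕ i * 𝟙 (Active? (suc (toℕ i)) s u))
            ≡⟨ cong₂ _+_ (sym (active u∋v 0 z≤n)) (sum-cong-≗ {J} λ i → cong (_* 𝟙 (Active? (suc (toℕ i)) s u)) (+-identityʳ (2 ^ toℕ i))) ⟩
          coeff s u                                    ∎
        rearrange : ∀ p a x → p * (a * x) ≡ a * (x * p)
        rearrange = solve-∀
        termwise : ∀ u → 2 ^ k * (𝟙 (u ∋? v) * w u) ≤ 𝟙 (u ∋? v) * (w u * coeff s u)
        termwise u with u ∋? v
        ... | no  _   = ≤-reflexive (*-zeroʳ (2 ^ k))
        ... | yes u∋v = begin
          2 ^ k * (1 * w u)       ≡⟨ rearrange (2 ^ k) 1 (w u) ⟩
          1 * (w u * 2 ^ k)       ≤⟨ *-monoʳ-≤ 1 (*-monoʳ-≤ (w u) (2^k≤coeff u∋v)) ⟩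
          1 * (w u * coeff s u)   ∎

      module _ (r : ℕ) where

        sum-active : ∀ i u → sum {r} (λ s → 𝟙 (Active? i (toℕ s) u)) ≤ 2 * T * 2 ^ (suc J ∸ i)
        sum-active i u = sum-bounded-diameter r (λ s → Active? i s u) (active-diameter {i} {u})

        -- Scale 0 contributes at most 2T · 2^(J+1). At each of the J others the factor 2^i offsets
        -- the smaller diameter, leaving 2T · 2^J.
        sum-coeff : ∀ u → sum {r} (λ s → coeff (toℕ s) u) ≤ 2 * T * ((2 + J) * 2 ^ J)
        sum-coeff u = begin
          sum {r} (λ s → coeff (toℕ s) u)
            ≡⟨ ∑-distrib-+ {r} (λ s → 𝟙 (Active? 0 (toℕ s) u)) (λ s → sum {J} (term s)) ⟩
          sum {r} (λ s → 𝟙 (Active? 0 (toℕ s) u)) + sum {r} (λ s → sum {J} (term s))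
            ≡⟨ cong (sum {r} (λ s → 𝟙 (Active? 0 (toℕ s) u)) +_) (∑-comm {r} {J} term) ⟩
          sum {r} (λ s → 𝟙 (Active? 0 (toℕ s) u)) + sum {J} (λ i → sum {r} (λ s → term s i))
            ≤⟨ +-mono-≤ (sum-active 0 u) (sum≤n*c {J} column) ⟩
          2 * T * (2 * 2 ^ J) + J * (2 * T * 2 ^ J)
            ≡⟨ rearrange T J (2 ^ J) ⟩
          2 * T * ((2 + J) * 2 ^ J) ∎
          where
          open ≤-Reasoning
          term : Fin r → Fin J → ℕ
          term s i = 2 ^ toℕ i * 𝟙 (Active? (suc (toℕ i)) (toℕ s) u)
          rearrange : ∀ T J p → 2 * T * (2 * p) + J * (2 * T * p) ≡ 2 * T * ((2 + J) * p)
          rearrange = solve-∀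
          rearrange′ : ∀ p T q → p * (2 * T * q) ≡ 2 * T * (p * q)
          rearrange′ = solve-∀
          column : ∀ i → sum {r} (λ s → term s i) ≤ 2 * T * 2 ^ J
          column i = begin
            sum {r} (λ s → term s i)             ≡⟨ *-distribˡ-sum {r} (2 ^ toℕ i) (λ s → 𝟙 (Active? (suc (toℕ i)) (toℕ s) u)) ⟨
            2 ^ toℕ i * sum {r} (λ s → 𝟙 (Active? (suc (toℕ i)) (toℕ s) u)) ≤⟨ *-monoʳ-≤ (2 ^ toℕ i) (sum-active (suc (toℕ i)) u) ⟩
            2 ^ toℕ i * (2 * T * 2 ^ (J ∸ toℕ i)) ≡⟨ rearrange′ (2 ^ toℕ i) T _ ⟩
            2 * T * (2 ^ toℕ i * 2 ^ (J ∸ toℕ i)) ≡⟨ cong (2 * T *_) (^-distribˡ-+-* 2 (toℕ i) (J ∸ toℕ i)) ⟨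
            2 * T * 2 ^ (toℕ i + (J ∸ toℕ i))     ≡⟨ cong (λ e → 2 * T * 2 ^ e) (m+[n∸m]≡n (<⇒≤ (Fin.toℕ<n i))) ⟩
            2 * T * 2 ^ J                         ∎

        sum-cost : sum {r} (λ s → cost (toℕ s)) ≤ W * (2 * T * ((2 + J) * 2 ^ J))
        sum-cost = begin
          sum {r} (λ s → sum (λ u → w u * coeff (toℕ s) u))   ≡⟨ ∑-comm {r} {n} (λ s u → w u * coeff (toℕ s) u) ⟩
          sum (λ u → sum {r} (λ s → w u * coeff (toℕ s) u))   ≡⟨ sum-cong-≗ (λ u → *-distribˡ-sum {r} (w u) (λ s → coeff (toℕ s) u)) ⟨
          sum (λ u → w u * sum {r} (λ s → coeff (toℕ s) u))   ≤⟨ sum-mono (λ u → *-monoʳ-≤ (w u) (sum-coeff u)) ⟩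
          sum (λ u → w u * (2 * T * ((2 + J) * 2 ^ J)))       ≡⟨ *-distribʳ-sum (2 * T * ((2 + J) * 2 ^ J)) w ⟨
          W * (2 * T * ((2 + J) * 2 ^ J))                     ∎
          where open ≤-Reasoning

      -- Over the radii 0 to `s₀` the costs sum to at most 2W · T(2 + J) · 2^J, and 2W is at most f
      -- per radius. So some radius costs at most f · T(2 + J) · 2^J.
      round : ∀ {s₀ f} {A : Subset n} → (∀ a → a ∈ A → ¬ Near s₀ a) → 2 * W ≤ suc s₀ * f →
              ∃ λ S → Separator G ⊤ A B S × ∃ λ y → FracCover S y × totalWeight y ℚ.≤ ℕtoℚ (f * (T * (2 + J)))
      round {s₀} {f} far 2W≤ with some-term≤average (λ s → cost (toℕ s)) (begin
        sum {suc s₀} (λ s → cost (toℕ s))       ≤⟨ sum-cost (suc s₀) ⟩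
        W * (2 * T * ((2 + J) * 2 ^ J))         ≡⟨ rearrange W T J (2 ^ J) ⟩
        2 * W * (T * (2 + J) * 2 ^ J)           ≤⟨ *-monoˡ-≤ (T * (2 + J) * 2 ^ J) 2W≤ ⟩
        suc s₀ * f * (T * (2 + J) * 2 ^ J)      ≡⟨ rearrange′ (suc s₀) f (T * (2 + J)) (2 ^ J) ⟩
        suc s₀ * (f * (T * (2 + J)) * 2 ^ J)    ∎)
        where
        open ≤-Reasoning
        rearrange : ∀ W T J p → W * (2 * T * ((2 + J) * p)) ≡ 2 * W * (T * (2 + J) * p)
        rearrange = solve-∀
        rearrange′ : ∀ r f t p → r * f * (t * p) ≡ r * (f * t * p)
        rearrange′ = solve-∀
      ... | i , cost≤ =
        boundary s , boundary-separates (λ a a∈A near → far a a∈A (Near-mono (≤-pred (Fin.toℕ<n i)) near)) ,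
        scaled (2 ^ J) k , scaled-fracCover (2 ^ J) k (boundary s) (boundary-covered s) , totalWeight-scaled (2 ^ J) k (f * (T * (2 + J))) cost≤
        where
        s = toℕ i
        k : Fin n → ℕ
        k u = w u * coeff s u
        instance
          2^J≢0 : NonZero (2 ^ J)
          2^J≢0 = m^n≢0 2 J

-- Selecting cheap walks

module Selection {n : ℕ} (G : Graph n) {m : ℕ} (ℓ : Fin n → Fin m) (A B : Subset n)
                 (T : ℕ) (thick : Layered.ThicknessAtMost G ℓ T) (n≤2^T : n ≤ 2 ^ T) where
  open Layered G ℓ
  open Walks G
  open Family ℓ
  open Covering G ℓ

  record ThinWalk : Set where
    field
      {start end} : Fin n
      start∈A : start ∈ A
      end∈B   : end ∈ B
      walk    : Walk start end
      isThin  : Thin T walk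

    support : List (Fin n)
    support = vertices walk

  open ThinWalk

  hits : Fin n → List ThinWalk → ℕ
  hits u []       = 0
  hits u (P ∷ Ps) = 𝟙 (Hits? u (support P)) + hits u Ps

  weight : List ThinWalk → Fin n → ℕ
  weight Ps u = 2 ^ hits u Ps

  1≤weight : ∀ Ps u → 1 ≤ weight Ps u
  1≤weight Ps u = m^n>0 2 (hits u Ps)

  module At (Ps : List ThinWalk) = Weighted (weight Ps) (1≤weight Ps) B

  -- Selecting `P` doubles the weight of exactly the members that it meets.
  W-∷ : ∀ P Ps → At.W (P ∷ Ps) ≡ At.W Ps + At.hitWeight Ps (support P)
  W-∷ P Ps = trans (sum-cong-≗ double)
                   (∑-distrib-+ (weight Ps) (λ u → 𝟙 (Hits? u (support P)) * weight Ps u))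
    where
    double : ∀ u → weight (P ∷ Ps) u ≡ weight Ps u + 𝟙 (Hits? u (support P)) * weight Ps u
    double u with Hits? u (support P)
    ... | yes _ = refl
    ... | no  _ = sym (+-identityʳ (weight Ps u))

  module _ (f : ℕ) .{{_ : NonZero f}} where

    -- Large enough for `steps` ≥ f · T, small enough for (1 + 1/f)^(2 · `steps`) ≤ 2^(4T).
    steps : ℕ
    steps = 2 * T * ⌈ f /2⌉

    -- After k selections W ≤ (1 + 1/f)^(2k) · n, cleared of denominators.
    Moderate : List ThinWalk → Set
    Moderate Ps = (f * f) ^ length Ps * At.W Ps ≤ (suc f * suc f) ^ length Ps * n

    moderate-[] : Moderate []
    moderate-[] = *-monoʳ-≤ 1 (≤-trans (sum≤n*c {n} (λ _ → ≤-refl)) (≤-reflexive (*-identityʳ n)))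

    moderate-∷ : ∀ P Ps → Moderate Ps → At.hitWeight Ps (support P) * f ≤ 2 * At.W Ps → Moderate (P ∷ Ps)
    moderate-∷ P Ps mod hw*f≤ = begin
      f * f * F * At.W (P ∷ Ps)           ≡⟨ cong (f * f * F *_) (W-∷ P Ps) ⟩
      f * f * F * (W + hw)                ≡⟨ rearrange f F W hw ⟩
      F * (f * f * W + f * (hw * f))      ≤⟨ *-monoʳ-≤ F (+-monoʳ-≤ (f * f * W) (*-monoʳ-≤ f hw*f≤)) ⟩
      -- Adding `W` completes f² + 2f to (f + 1)².
      F * (f * f * W + f * (2 * W))       ≤⟨ *-monoʳ-≤ F (m≤m+n _ W) ⟩
      F * (f * f * W + f * (2 * W) + W)   ≡⟨ rearrange′ f F W ⟩
      suc f * suc f * (F * W)             ≤⟨ *-monoʳ-≤ (suc f * suc f) mod ⟩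
      suc f * suc f * (F′ * n)            ≡⟨ *-assoc (suc f * suc f) F′ n ⟨
      suc f * suc f * F′ * n              ∎
      where
      open ≤-Reasoning
      F = (f * f) ^ length Ps
      F′ = (suc f * suc f) ^ length Ps
      W = At.W Ps
      hw = At.hitWeight Ps (support P)
      rearrange : ∀ f F W h → f * f * F * (W + h) ≡ F * (f * f * W + f * (h * f))
      rearrange = solve-∀
      rearrange′ : ∀ f F W → F * (f * f * W + f * (2 * W) + W) ≡ suc f * suc f * (F * W)
      rearrange′ = solve-∀

    -- The bound is first weakened to the full `steps` selections; these account for 2^(4T), and the
    -- initial weight n for 2^T.
    W≤2^5T : ∀ Ps → length Ps ≤ steps → Moderate Ps → At.W Ps ≤ 2 ^ (5 * T)
    W≤2^5T Ps k≤ mod = *-cancelˡ-≤ (Q ^ K) (begin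
      Q ^ K * At.W Ps                     ≡⟨ cong (λ e → Q ^ e * At.W Ps) (m+[n∸m]≡n k≤) ⟨
      Q ^ (k + j) * At.W Ps               ≡⟨ cong (_* At.W Ps) (^-distribˡ-+-* Q k j) ⟩
      Q ^ k * Q ^ j * At.W Ps             ≡⟨ rearrange (Q ^ k) (Q ^ j) (At.W Ps) ⟩
      Q ^ j * (Q ^ k * At.W Ps)           ≤⟨ *-mono-≤ (^-monoˡ-≤ j (*-mono-≤ (n≤1+n f) (n≤1+n f))) mod ⟩
      Q′ ^ j * (Q′ ^ k * n)               ≡⟨ rearrange (Q′ ^ k) (Q′ ^ j) n ⟨
      Q′ ^ k * Q′ ^ j * n                 ≡⟨ cong (_* n) (^-distribˡ-+-* Q′ k j) ⟨
      Q′ ^ (k + j) * n                    ≡⟨ cong (λ e → Q′ ^ e * n) (m+[n∸m]≡n k≤) ⟩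
      Q′ ^ K * n                          ≤⟨ *-mono-≤ Q′^K≤ n≤2^T ⟩
      2 ^ (4 * T) * Q ^ K * 2 ^ T         ≡⟨ rearrange′ (2 ^ (4 * T)) (Q ^ K) (2 ^ T) ⟩
      Q ^ K * (2 ^ T * 2 ^ (4 * T))       ≡⟨ cong (Q ^ K *_) (^-distribˡ-+-* 2 T (4 * T)) ⟨
      Q ^ K * 2 ^ (5 * T)                 ∎)
      where
      open ≤-Reasoning
      Q = f * f
      Q′ = suc f * suc f
      K = steps
      k = length Ps
      j = K ∸ k
      instance
        Q≢0 : NonZero Q
        Q≢0 = m*n≢0 f f
        Q^K≢0 : NonZero (Q ^ K)
        Q^K≢0 = m^n≢0 Q K
      rearrange : ∀ a b c → a * b * c ≡ b * (a * c)
      rearrange = solve-∀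
      rearrange′ : ∀ a b c → a * b * c ≡ b * (c * a)
      rearrange′ = solve-∀
      exponent : ∀ T g → 2 * (2 * T * g) ≡ g * (4 * T)
      exponent = solve-∀
      square^K : ∀ a → (a * a) ^ K ≡ a ^ (⌈ f /2⌉ * (4 * T))
      square^K a = trans (cong (λ z → (a * z) ^ K) (sym (*-identityʳ a)))
                  (trans (^-*-assoc a 2 K) (cong (a ^_) (exponent T ⌈ f /2⌉)))
      Q′^K≤ : Q′ ^ K ≤ 2 ^ (4 * T) * Q ^ K
      Q′^K≤ = begin
        Q′ ^ K                                       ≡⟨ square^K (suc f) ⟩
        suc f ^ (⌈ f /2⌉ * (4 * T))                  ≤⟨ [1+f]^e≤2^4T*f^e f T ⟩
        2 ^ (4 * T) * f ^ (⌈ f /2⌉ * (4 * T))        ≡⟨ cong (2 ^ (4 * T) *_) (square^K f) ⟨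
        2 ^ (4 * T) * Q ^ K                          ∎

    CheapSeparator : Set
    CheapSeparator = ∃ λ S → Separator G ⊤ A B S × ∃ λ y → FracCover S y ×
                       totalWeight y ℚ.≤ ℕtoℚ (f * (T * (2 + 5 * T)))

    select : ∀ k → k ≤ steps → CheapSeparator ⊎ ∃ λ Ps → length Ps ≡ k × Moderate Ps
    select zero    _   = inj₂ ([] , refl , moderate-[])
    select (suc k) k<K with select k (<⇒≤ k<K)
    ... | inj₁ cheap = inj₁ cheap
    ... | inj₂ (Ps , refl , mod) with Fin.any? (λ a → (a ∈? A) ×-dec At.Near? Ps (2 * At.W Ps / f) a)
    -- The quotient is rounded down, yet with radius 0 included there are enough radii: 2W < (⌊2W/f⌋
    -- + 1) · f.
    ...   | no ¬near = inj₁ (At.Rounding.round Ps T (5 * T) thick (W≤2^5T Ps (<⇒≤ k<K) mod) {2 * At.W Ps / f} {f}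
                        (λ a a∈A near → ¬near (a , a∈A , near)) (<⇒≤ (m<[1+m/n]*n (2 * At.W Ps) f)))
    ...   | yes (a , a∈A , near) with At.Near⇒walk Ps near
    ...     | b , b∈B , p , hw≤ with thin thick p
    ...       | q , q-thin , q-dom = inj₂ (Q ∷ Ps , refl , moderate-∷ Q Ps mod (begin
                  At.hitWeight Ps (vertices q) * f   ≤⟨ *-monoˡ-≤ f (≤-trans (At.hitWeight-dominated Ps q-dom) hw≤) ⟩
                  2 * At.W Ps / f * f                ≤⟨ m/n*n≤m (2 * At.W Ps) f ⟩
                  2 * At.W Ps                        ∎))
      where
      open ≤-Reasoning
      Q : ThinWalk
      Q = record { start∈A = a∈A ; end∈B = b∈B ; walk = q ; isThin = q-thin }

    -- The weight of a single member is 2 to the number of its hits and at most `W`.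
    hits≤5T : ∀ Ps → length Ps ≤ steps → Moderate Ps → ∀ u → hits u Ps ≤ 5 * T
    hits≤5T Ps k≤ mod u = ^-reflects-≤ (≤-trans (term≤sum (weight Ps) u) (W≤2^5T Ps k≤ mod))

  -- Degrees and covers in the subgraph induced by the selected walks

  OnSome : List ThinWalk → Fin n → Set
  OnSome Ps v = Any (λ P → v ∈ˡ support P) Ps

  OnSome? : ∀ Ps v → Dec (OnSome Ps v)
  OnSome? Ps v = Any.any? (λ P → Any.any? (v Fin.≟_) (support P)) Ps

  union : List ThinWalk → Subset n
  union Ps = subsetOf (OnSome? Ps)

  below : Fin n → List ThinWalk → List (Fin n)
  below u []       = []
  below u (P ∷ Ps) = filter (Reach? u) (support P) ++ below u Ps

  ∈-below : ∀ {u w} Ps → Reach u w → OnSome Ps w → w ∈ˡ below u Ps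
  ∈-below {u} (P ∷ Ps) uw (here w∈P)  = ∈-++⁺ˡ (∈-filter⁺ (Reach? u) w∈P uw)
  ∈-below {u} (P ∷ Ps) uw (there w∈)  = ∈-++⁺ʳ (filter (Reach? u) (support P)) (∈-below Ps uw w∈)

  -- Only the walks that meet the member contribute, each at most 2T vertices by thinness.
  length-below : ∀ {u} → Source u → ∀ Ps → length (below u Ps) ≤ hits u Ps * (2 * T)
  length-below     src []       = z≤n
  length-below {u} src (P ∷ Ps) = begin
    length (filter (Reach? u) (support P) ++ below u Ps)         ≡⟨ length-++ (filter (Reach? u) (support P)) ⟩
    length (filter (Reach? u) (support P)) + length (below u Ps) ≤⟨ +-mono-≤ first (length-below src Ps) ⟩
    𝟙 (Hits? u (support P)) * (2 * T) + hits u Ps * (2 * T)      ≡⟨ *-distribʳ-+ (2 * T) (𝟙 (Hits? u (support P))) _ ⟨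
    (𝟙 (Hits? u (support P)) + hits u Ps) * (2 * T)              ∎
    where
    open ≤-Reasoning
    first : length (filter (Reach? u) (support P)) ≤ 𝟙 (Hits? u (support P)) * (2 * T)
    first with Hits? u (support P)
    ... | yes _   = ≤-trans (isThin P u src) (≤-reflexive (sym (+-identityʳ (2 * T))))
    ... | no ¬hit = ≤-reflexive (cong length (filter-none (Reach? u) (All.map (_∘ (src ,_)) (¬Any⇒All¬ (support P) ¬hit))))

  -- In a member containing `v`, the subgraph has at most h · 2T vertices; outside of it `v` has at
  -- most `k` neighbours.
  degree-bound : ∀ {k} → NeighborhoodWitnessing k → ∀ {h} Ps → (∀ u → hits u Ps ≤ h) →
                 ∀ v → degIn G (union Ps) v ≤ h * (2 * T) + k
  degree-bound {k} witness {h} Ps hits≤ v with source-above v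
  ... | u , src , uv = begin
    ∣ N G v ∩ union Ps ∣               ≤⟨ ∣p∣≤length+∣q∣ (N G v ∩ union Ps) beyond (below u Ps) split ⟩
    length (below u Ps) + ∣ beyond ∣  ≤⟨ +-mono-≤ (≤-trans (length-below src Ps) (*-monoˡ-≤ (2 * T) (hits≤ u))) ∣beyond∣≤k ⟩
    h * (2 * T) + k                    ∎
    where
    open ≤-Reasoning
    beyond? : ∀ w → Dec (Adj G v w × ¬ Reach u w)
    beyond? w = Adj? v w ×-dec ¬? (Reach? u w)
    beyond : Subset n
    beyond = subsetOf beyond?
    split : ∀ {w} → w ∈ N G v ∩ union Ps → w ∈ˡ below u Ps ⊎ w ∈ beyond
    split {w} w∈ with x∈p∩q⁻ (N G v) (union Ps) w∈ | Reach? u w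
    ... | _ , w∈U    | yes uw = inj₁ (∈-below Ps uw (∈-subsetOf⁻ (OnSome? Ps) w∈U))
    ... | w∈N , _    | no ¬uw = inj₂ (∈-subsetOf⁺ beyond? (∈-N⁻ w∈N , ¬uw))
    ∣beyond∣≤k : ∣ beyond ∣ ≤ k
    ∣beyond∣≤k = ≮⇒≥ λ k< →
      let g , g-inj , g∈ = enumerate beyond k<
      in witness u v src uv g g-inj λ i →
           let vw , ¬uw = ∈-subsetOf⁻ beyond? (g∈ i) in inj₂ vw , ¬uw

  -- A selected walk lies in the subgraph, and so does the simple path it contains, which the
  -- separator must meet.
  walk-met : ∀ {Ps S} → Separator G (union Ps) (A ∩ union Ps) (B ∩ union Ps) S →
             ∀ {P} → P ∈ˡ Ps → ∃ λ z → z ∈ˡ support P × z ∈ S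
  walk-met {Ps} {S} sep {P} P∈ =
    let z , z∈ , z∈S = find (sep (start P) (SimplePath.rest path)
                         (x∈p∩q⁺ (start∈A P , in-union (source∈ (walk P))))
                         (subst (_∈ B ∩ union Ps) (sym (SimplePath.last≡ path))
                           (x∈p∩q⁺ (end∈B P , in-union (target∈ (walk P)))))
                         (SimplePath.linked path) (SimplePath.unique path)
                         (All.map in-union (SimplePath.all path)))
    in z , All.lookup (SimplePath.all path) z∈ , z∈S
    where
    in-union : ∀ {z} → z ∈ˡ support P → z ∈ union Ps
    in-union z∈ = ∈-subsetOf⁺ (OnSome? Ps) (lose P∈ z∈)
    path : SimplePath (start P) (end P) (_∈ˡ support P)
    path = simplify (walk P) id

  sum-hits : List (Fin n) → List ThinWalk → ℕ
  sum-hits us Ps = sumˡ (map (λ u → hits u Ps) us)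

  sum-hits-∷ : ∀ us P Ps → Any (λ u → Hits u (support P)) us → suc (sum-hits us Ps) ≤ sum-hits us (P ∷ Ps)
  sum-hits-∷ (u ∷ us) P Ps (here hit) =
    +-mono-≤ {suc (hits u Ps)} (+-monoˡ-≤ (hits u Ps) (≤-reflexive (sym (𝟙-yes (Hits? u (support P)) hit)))) (rest us)
    where
    rest : ∀ us → sum-hits us Ps ≤ sum-hits us (P ∷ Ps)
    rest []       = z≤n
    rest (u ∷ us) = +-mono-≤ (m≤n+m (hits u Ps) _) (rest us)
  sum-hits-∷ (u ∷ us) P Ps (there hit) =
    ≤-trans (≤-reflexive (sym (+-suc (hits u Ps) _)))
            (+-mono-≤ (m≤n+m (hits u Ps) _) (sum-hits-∷ us P Ps hit))

  -- Counts the pairs of a listed member and a walk it meets: every walk is in at least one.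
  length≤sum-hits : ∀ us Ps → (∀ {P} → P ∈ˡ Ps → Any (λ u → Hits u (support P)) us) → length Ps ≤ sum-hits us Ps
  length≤sum-hits us []       met = z≤n
  length≤sum-hits us (P ∷ Ps) met =
    ≤-trans (s≤s (length≤sum-hits us Ps (met ∘ there))) (sum-hits-∷ us P Ps (met (here refl)))

  cover-bound : ∀ {h} Ps → (∀ u → hits u Ps ≤ h) → ∀ S us →
                Separator G (union Ps) (A ∩ union Ps) (B ∩ union Ps) S → Cover S us → length Ps ≤ length us * h
  cover-bound {h} Ps hits≤ S us sep (srcs , covers) = ≤-trans (length≤sum-hits us Ps met) (bound us)
    where
    bound : ∀ us → sum-hits us Ps ≤ length us * h
    bound []       = z≤n
    bound (u ∷ us) = +-mono-≤ (hits≤ u) (bound us)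
    met : ∀ {P} → P ∈ˡ Ps → Any (λ u → Hits u (support P)) us
    met P∈ =
      let z , z∈P , z∈S = walk-met sep P∈
          u , u∈ , uz   = find (covers z z∈S)
      in lose u∈ (lose z∈P (All.lookup srcs u∈ , uz))

-- The two outcomes and their constants

theorem8p7 : ∀ (d f n : ℕ) → 1 ≤ d → 1 ≤ f →
    ∀ (G : Graph n) → HasDegeneracy G d →
    ∀ (m : ℕ) (ℓ : Fin n → Fin m) →
    Layered.IsOrderedPartition G ℓ →
    Layered.NeighborhoodWitnessing G ℓ (4 * d) →
    Layered.ThicknessAtMost G ℓ ⌈log₂ n ⌉ →
    ∀ (A B : Subset n) →
    (∃ λ (S : Subset n) → Separator G ⊤ A B S ×
    ∃ λ (y : Fin n → ℚ) → Layered.FracCover G ℓ S y ×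
    LeCLog² (Layered.totalWeight G ℓ y) (8 * f) (2 * n))
    ⊎
    (∃ λ (H : Subset n) →
    (∀ v → v ∈ H → LeCLog² (ℕtoℚ (degIn G H v ∸ 4 * d)) 12 (2 * n)) ×
    (∀ (S : Subset n) → S ⊆ H → Separator G H (A ∩ H) (B ∩ H) S →
    Layered.CovAtLeastSixth G ℓ S f))
theorem8p7 zero    f zero () _ G _ _ _ _ _ _ _ _
-- Without vertices every degeneracy bound holds vacuously, against the minimality of `suc d`.
theorem8p7 (suc d) f zero _ _ G (_ , ¬deg) _ _ _ _ _ _ _ = contradiction (λ { _ (() , _) }) ¬deg
theorem8p7 d f n@(suc _) _ 1≤f G _ m ℓ _ witness thick A B =
  [ (λ (S , sep , y , cover , total≤) → inj₁ (S , sep , y , cover ,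
        ≤c*T²⇒LeCLog² (8 * f) T (ℚ.≤-trans total≤ (ℕtoℚ-mono-≤ fT[2+5T]≤8fT²)) 2^T≤2n))
  , (λ (Ps , len≡ , mod) →
        let hits≤ = hits≤5T f Ps (≤-reflexive len≡) mod
        in inj₂ (union Ps ,
             (λ v _ → ≤c*T²⇒LeCLog² 12 T (ℕtoℚ-mono-≤ (degree≤ (degree-bound witness Ps hits≤ v))) 2^T≤2n) ,
             λ S _ sep us cover → f≤6c (length us) (subst (_≤ length us * (5 * T)) len≡ (cover-bound Ps hits≤ S us sep cover))))
  ]′ (select f (steps f) ≤-refl)
  where
  open ≤-Reasoning
  T : ℕ
  T = ⌈log₂ n ⌉
  open Selection G ℓ A B T thick (n≤2^⌈log₂n⌉ n)
  2^T≤2n : 2 ^ T ≤ 2 * n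
  2^T≤2n = 2^⌈log₂n⌉≤2n n
  -- A source alone already meets one layer, so the thickness bound rules out T = 0.
  1≤T : 1 ≤ T
  1≤T = let _ , src , _ = Walks.Family.source-above G ℓ zero
        in Walks.Family.depth<thickness G ℓ thick src Layered.here
  instance
    f≢0 : NonZero f
    f≢0 = >-nonZero 1≤f
    T≢0 : NonZero T
    T≢0 = >-nonZero 1≤T
  -- The constant 8 arises from J = 5T and 2 ≤ 3T.
  fT[2+5T]≤8fT² : f * (T * (2 + 5 * T)) ≤ 8 * f * (T * T)
  fT[2+5T]≤8fT² = begin
    f * (T * (2 + 5 * T))          ≤⟨ *-monoʳ-≤ f (*-monoʳ-≤ T (+-monoˡ-≤ (5 * T) (≤-trans (n≤1+n 2) (*-monoʳ-≤ 3 1≤T)))) ⟩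
    f * (T * (3 * T + 5 * T))      ≡⟨ rearrange f T ⟩
    8 * f * (T * T)                ∎
    where
    rearrange : ∀ f T → f * (T * (3 * T + 5 * T)) ≡ 8 * f * (T * T)
    rearrange = solve-∀
  degree≤ : ∀ {δ} → δ ≤ 5 * T * (2 * T) + 4 * d → δ ∸ 4 * d ≤ 12 * (T * T)
  degree≤ {δ} δ≤ = begin
    δ ∸ 4 * d                             ≤⟨ ∸-monoˡ-≤ (4 * d) δ≤ ⟩
    5 * T * (2 * T) + 4 * d ∸ 4 * d       ≡⟨ m+n∸n≡m (5 * T * (2 * T)) (4 * d) ⟩
    5 * T * (2 * T)                       ≡⟨ rearrange T ⟩
    10 * (T * T)                          ≤⟨ *-monoˡ-≤ (T * T) (m≤n+m 10 2) ⟩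
    12 * (T * T)                          ∎
    where
    rearrange : ∀ T → 5 * T * (2 * T) ≡ 10 * (T * T)
    rearrange = solve-∀
  -- Since `steps` is at least f · T, cancelling T leaves f ≤ 5c.
  f≤6c : ∀ c → steps f ≤ c * (5 * T) → f ≤ 6 * c
  f≤6c c K≤ = *-cancelʳ-≤ f (6 * c) T (begin
    f * T                    ≤⟨ *-monoˡ-≤ T (f≤2⌈f/2⌉ f) ⟩
    2 * ⌈ f /2⌉ * T          ≡⟨ rearrange ⌈ f /2⌉ T ⟩
    2 * T * ⌈ f /2⌉          ≤⟨ K≤ ⟩
    c * (5 * T)              ≤⟨ *-monoʳ-≤ c (*-monoˡ-≤ T (n≤1+n 5)) ⟩
    c * (6 * T)              ≡⟨ rearrange′ c T ⟩
    6 * c * T                ∎)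
    where
    rearrange : ∀ g T → 2 * g * T ≡ 2 * T * g
    rearrange = solve-∀
    rearrange′ : ∀ c T → c * (6 * T) ≡ 6 * c * T
    rearrange′ = solve-∀
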